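{- Let $\mathcal H=(V,E)$ be a locally finite simple hypergraph. Let $x,y\in V$ with $x\sim_{\mathcal H}y$. Then $$\kappa_{LLY}^{\mathcal H}(x,y)=\frac{\kappa_\alpha^{\mathcal H}(x,y)}{1-\alpha}\qquad\text{for all }\alpha\in\left[\frac12,1\right).$$ If moreover $\mathcal H$ is $r$-uniform and linear, then $$\kappa_{LLY}^{\mathcal H}(x,y)=\frac{\kappa_\alpha^{\mathcal H}(x,y)}{1-\alpha}\qquad\text{for all }\alpha\in\left[\frac{1}{\max\left(d_x^{\mathcal H},d_y^{\mathcal H}\right)(r-1)+1},1\right).$$
   Context: A hypergraph $\mathcal H=(V,E)$ consists of a vertex set $V$ and a set $E$ of finite subsets of $V$ (hyperedges). It is simple if $|e|\ge 2$ for every $e\in E$ and, for distinct $e,f\in E$, neither $e\subseteq f$ nor $f\subseteq e$. It is locally finite if each vertex belongs to only finitely many hyperedges; every hyperedge is finite. It is $r$-uniform if $|e|=r$ for all $e\in E$, and linear if any two distinct hyperedges have at most one vertex in common. The incidence degree of $x\in V$ is $d_x^{\mathcal H}:=\#\{e\in E: x\in e\}$. Two distinct vertices are adjacent, $x\sim_{\mathcal H}y$, if they lie in a common hyperedge. A hyperpath joining $u,v\in V$ is a finite sequence $(e_1,\dots,e_l)$ of distinct hyperedges with $u\in e_1$, $v\in e_l$ and $e_j\cap e_{j+1}\ne\varnothing$ for $1\le j\le l-1$. The distance $d_{\mathcal H}(u,v)$ is the minimum number $l$ of hyperedges in a hyperpath joining $u$ and $v$ ($\infty$ if none exists), and $d_{\mathcal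 H}(u,u)=0$. For finitely supported probability measures $\mu_1,\mu_2$ on $V$, the $1$-Wasserstein distance is $$W_1^{\mathcal H}(\mu_1,\mu_2):=\inf_{\pi}\sum_{u\in V}\sum_{v\in V}d_{\mathcal H}(u,v)\,\pi(u,v)$$ (with $\infty\cdot 0=0$), where the infimum is over all $\pi:V\times V\to[0,1]$ with $\sum_{w}\pi(u,w)=\mu_1(u)$ and $\sum_{w}\pi(w,v)=\mu_2(v)$ for all $u,v\in V$. For $x\in V$ and idleness $\alpha\in[0,1]$, the probability measure $\mu_x^\alpha$ on $V$ is defined by $\mu_x^\alpha(x)=\alpha$; $\mu_x^\alpha(z)=\frac{1-\alpha}{d_x^{\mathcal H}}\sum_{e\in E,\ e\supseteq\{x,z\}}\frac{1}{|e|-1}$ if $z\sim_{\mathcal H}x$; and $\mu_x^\alpha(z)=0$ otherwise. The $\alpha$-Ollivier--Ricci curvature is $$\kappa_\alpha^{\mathcal H}(x,y):=1-\frac{W_1^{\mathcal H}(\mu_x^\alpha,\mu_y^\alpha)}{d_{\mathcal H}(x,y)},$$ and the Lin--Lu--Yau curvature is $$\kappa_{LLY}^{\mathcal H}(x,y):=\lim_{\alpha\uparrow1}\frac{\kappa_\alpha^{\mathcal H}(x,y)}{1-\alpha}.$$ -}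

module Defs where

open import Algebra.Bundles using (CommutativeRing)
open import Algebra.Core using (Op₁; Op₂)
open import Algebra.Structures using (IsCommutativeRing)
import Algebra.Definitions.RawMonoid as RawMonoidDefinitions
import Algebra.Properties.Ring as RingProperties
open import Axiom.ExcludedMiddle using (ExcludedMiddle)
open import Data.List.Base using (List; foldr; map; filter; length)
open import Data.List.Membership.Propositional using (_∈_)
open import Data.List.NonEmpty.Base as List⁺ using (List⁺; toList)
open import Data.List.Relation.Binary.Subset.Propositional using (_⊆_)
open import Data.List.Relation.Unary.Linked using (Linked)
open import Data.List.Relation.Unary.Unique.Propositional using (Unique)
open import Data.Nat.Base as ℕ using (ℕ; zero; suc)
open import Data.Nat.Induction using (<-rec)
import Data.Nat.Properties as ℕₚ
open import Data.Product.Base using (Σ; ∃; ∃₂; _×_; _,_; proj₁; proj₂)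
open import Data.Sum.Base using (_⊎_; inj₁; inj₂)
open import Function.Base using (_on_)
open import Function.Bundles using (_⇔_)
open import Level using (0ℓ)
open import Relation.Binary.Core using (Rel)
open import Relation.Binary.PropositionalEquality as ≡ using (_≡_; _≢_; refl)
open import Relation.Binary.Structures using (IsTotalOrder)
open import Relation.Nullary using (yes; no; ¬_; contradiction)
open import Relation.Nullary.Construct.Add.Supremum using (_⁺; [_]; ⊤⁺)
import Relation.Binary.Construct.Add.Supremum.Equality as SupremumEquality
import Relation.Binary.Construct.Add.Supremum.NonStrict as SupremumOrder

------------------------------------------------------------------------
-- Real numbers

-- ℝ is described axiomatically, as a Dedekind-complete totally ordered
-- field; these axioms determine it up to isomorphism.  As in the
-- library's algebra hierarchy, equality is a setoid equality.

record CompleteOrderedField : Set₁ where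
  infix  8 -_ _⁻¹
  infixl 7 _*_
  infixl 6 _+_
  infix  4 _≈_ _≤_
  field
    Carrier           : Set
    _≈_               : Rel Carrier 0ℓ
    _≤_               : Rel Carrier 0ℓ
    _+_               : Op₂ Carrier
    _*_               : Op₂ Carrier
    -_                : Op₁ Carrier
    0#                : Carrier
    1#                : Carrier
    isCommutativeRing : IsCommutativeRing _≈_ _+_ _*_ -_ 0# 1#
    -- The value of 0# ⁻¹ is left unspecified.
    _⁻¹               : Op₁ Carrier
    0≉1               : ¬ 0# ≈ 1#
    *-inverseʳ        : ∀ x → ¬ x ≈ 0# → x * x ⁻¹ ≈ 1#
    isTotalOrder      : IsTotalOrder _≈_ _≤_
    +-monoʳ-≤         : ∀ z {x y} → x ≤ y → z + x ≤ z + y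
    *-nonNegative     : ∀ {x y} → 0# ≤ x → 0# ≤ y → 0# ≤ x * y

  IsUpperBound : (Carrier → Set) → Carrier → Set
  IsUpperBound S b = ∀ x → S x → x ≤ b

  field
    complete : (S : Carrier → Set) → ∃ S → ∃ (IsUpperBound S) →
               ∃ λ s → IsUpperBound S s × (∀ b → IsUpperBound S b → s ≤ b)

  commutativeRing : CommutativeRing 0ℓ 0ℓ
  commutativeRing = record { isCommutativeRing = isCommutativeRing }

  open CommutativeRing commutativeRing public
    using (_-_; ring; +-rawMonoid; +-identityʳ; -‿inverseˡ)
    renaming (refl to ≈-refl; sym to ≈-sym; trans to ≈-trans)

  open IsTotalOrder isTotalOrder public
    using (total; antisym; ≤-respˡ-≈; ≤-respʳ-≈)
    renaming (refl to ≤-refl; trans to ≤-trans; reflexive to ≤-reflexive)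

  open import Relation.Binary.Construct.NonStrictToStrict _≈_ _≤_ public
    using (_<_)

  open RawMonoidDefinitions +-rawMonoid using () renaming (_×_ to _times_)

  fromℕ : ℕ → Carrier
  fromℕ n = n times 1#

  ½ : Carrier
  ½ = fromℕ 2 ⁻¹

  sum : List Carrier → Carrier
  sum = foldr _+_ 0#

  +-nonNegative : ∀ {x y} → 0# ≤ x → 0# ≤ y → 0# ≤ x + y
  +-nonNegative {x} 0≤x 0≤y =
    ≤-trans 0≤x (≤-respˡ-≈ (+-identityʳ x) (+-monoʳ-≤ x 0≤y))

  0≤1 : 0# ≤ 1#
  0≤1 with total 0# 1#
  ... | inj₁ 0≤1 = 0≤1
  ... | inj₂ 1≤0 = ≤-respʳ-≈ [-1]²≈1 (*-nonNegative 0≤-1 0≤-1)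
    where
    open RingProperties ring using (-1*x≈-x; -‿involutive)

    0≤-1 : 0# ≤ - 1#
    0≤-1 = ≤-respˡ-≈ (-‿inverseˡ 1#)
             (≤-respʳ-≈ (+-identityʳ (- 1#)) (+-monoʳ-≤ (- 1#) 1≤0))

    [-1]²≈1 : - 1# * - 1# ≈ 1#
    [-1]²≈1 = ≈-trans (-1*x≈-x (- 1#)) (-‿involutive 1#)

  0≤fromℕ : ∀ n → 0# ≤ fromℕ n
  0≤fromℕ zero    = ≤-refl
  0≤fromℕ (suc n) = +-nonNegative 0≤1 (0≤fromℕ n)

------------------------------------------------------------------------
-- Hypergraphs

-- A set of finite subsets of V: each hyperedge lists its elements
-- without repetition, and hyperedges with the same elements are equal.

record Hypergraph : Set₁ where
  field
    V           : Set
    E           : Set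
    vertices    : E → List V
    unique      : ∀ e → Unique (vertices e)
    extensional : ∀ e f → (∀ v → v ∈ vertices e ⇔ v ∈ vertices f) → e ≡ f

  infix 4 _∈ᴱ_ _∼_

  _∈ᴱ_ : V → E → Set
  v ∈ᴱ e = v ∈ vertices e

  ∣_∣ : E → ℕ
  ∣ e ∣ = length (vertices e)

  _∼_ : V → V → Set
  x ∼ y = x ≢ y × ∃ λ e → x ∈ᴱ e × y ∈ᴱ e

  Simple : Set
  Simple = (∀ e → 2 ℕ.≤ ∣ e ∣) ×
           (∀ e f → e ≢ f → ¬ (vertices e ⊆ vertices f))

  Uniform : ℕ → Set
  Uniform r = ∀ e → ∣ e ∣ ≡ r

  Linear : Set
  Linear = ∀ e f → e ≢ f → ∀ u v →
           u ∈ᴱ e → u ∈ᴱ f → v ∈ᴱ e → v ∈ᴱ f → u ≡ v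

  -- The hyperedges at each vertex can be listed without repetition; any
  -- two such listings are permutations of each other.
  LocallyFinite : Set
  LocallyFinite = ∀ x → ∃ λ es → Unique es × (∀ e → e ∈ es ⇔ x ∈ᴱ e)

  Meets : E → E → Set
  Meets e f = ∃ λ v → v ∈ᴱ e × v ∈ᴱ f

  IsHyperpath : V → V → List⁺ E → Set
  IsHyperpath u v es =
    Unique (toList es) × u ∈ᴱ List⁺.head es × v ∈ᴱ List⁺.last es ×
    Linked Meets (toList es)

------------------------------------------------------------------------
-- Minima, suprema and infima, with values in ℕ ∪ {∞} and [0,∞]

-- Excluded middle is a parameter because the classical definitions split
-- on undecidable conditions, such as the existence of a hyperpath.

module Extrema (lem : ExcludedMiddle 0ℓ) (ℛ : CompleteOrderedField) where
  open CompleteOrderedField ℛ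

  least : (P : ℕ → Set) → ∃ P → ∃ λ n → P n × (∀ m → P m → n ℕ.≤ m)
  least P (n , Pn) = <-rec Goal step n Pn
    where
    Goal : ℕ → Set
    Goal k = P k → ∃ λ n → P n × (∀ m → P m → n ℕ.≤ m)

    step : ∀ k → (∀ {j} → j ℕ.< k → Goal j) → Goal k
    step k rec Pk with lem {∃ λ j → j ℕ.< k × P j}
    ... | yes (j , j<k , Pj) = rec j<k Pj
    ... | no  none           =
      k , Pk , λ m Pm → ℕₚ.≮⇒≥ (λ m<k → none (m , m<k , Pm))

  minimum : (ℕ → Set) → ℕ ⁺
  minimum P with lem {∃ P}
  ... | yes ∃P = [ proj₁ (least P ∃P) ]
  ... | no  _  = ⊤⁺

  ℝ≥0 : Set
  ℝ≥0 = Σ Carrier (0# ≤_)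

  [0,∞] : Set
  [0,∞] = ℝ≥0 ⁺

  open SupremumEquality (_≈_ on proj₁ {B = 0# ≤_}) public
    using () renaming (_≈⁺_ to _≈∞_)
  open SupremumOrder (_≤_ on proj₁ {B = 0# ≤_}) public
    using (_≤⊤⁺) renaming (_≤⁺_ to _≤∞_; [_] to [_]≤)

  0∞ : [0,∞]
  0∞ = [ 0# , ≤-refl ]

  infixl 6 _+∞_

  _+∞_ : [0,∞] → [0,∞] → [0,∞]
  [ x , 0≤x ] +∞ [ y , 0≤y ] = [ x + y , +-nonNegative 0≤x 0≤y ]
  [ _ ]       +∞ ⊤⁺          = ⊤⁺
  ⊤⁺          +∞ _           = ⊤⁺

  infixl 7 _·_

  -- With the convention ∞ · 0 = 0.
  _·_ : ℕ ⁺ → ℝ≥0 → [0,∞]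
  [ n ] · (x , 0≤x) = [ fromℕ n * x , *-nonNegative (0≤fromℕ n) 0≤x ]
  ⊤⁺    · (x , _) with lem {x ≈ 0#}
  ... | yes _ = 0∞
  ... | no  _ = ⊤⁺

  module _ {I : Set} (f : I → [0,∞]) where

    IsSupremum : [0,∞] → Set
    IsSupremum s = (∀ i → f i ≤∞ s) × (∀ t → (∀ i → f i ≤∞ t) → s ≤∞ t)

    IsInfimum : [0,∞] → Set
    IsInfimum s = (∀ i → s ≤∞ f i) × (∀ t → (∀ i → t ≤∞ f i) → t ≤∞ s)

    supremum : ∃ IsSupremum
    supremum with lem {∃ λ b → ∀ i → f i ≤∞ [ b ]}
    ... | no unbounded = ⊤⁺ , (λ i → f i ≤⊤⁺) , top
      where
      top : ∀ t → (∀ i → f i ≤∞ t) → ⊤⁺ ≤∞ t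
      top ⊤⁺    _ = ⊤⁺ ≤⊤⁺
      top [ b ] h = contradiction (b , h) unbounded
    ... | yes (b , f≤b) = [ s , 0≤s ] , upper , lower
      where
      S : Carrier → Set
      S r = r ≈ 0# ⊎ ∃₂ λ i 0≤r → f i ≡ [ r , 0≤r ]

      boundS : ∀ c → (∀ i → f i ≤∞ [ c ]) → IsUpperBound S (proj₁ c)
      boundS (_ , 0≤c) h r (inj₁ r≈0)          = ≤-trans (≤-reflexive r≈0) 0≤c
      boundS c         h r (inj₂ (i , _ , eq)) with f i | h i | eq
      ... | _ | [ r≤c ]≤ | refl = r≤c

      lub = complete S (0# , inj₁ ≈-refl) (proj₁ b , boundS b f≤b)
      s   = proj₁ lub
      0≤s = proj₁ (proj₂ lub) 0# (inj₁ ≈-refl)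

      upper : ∀ i → f i ≤∞ [ s , 0≤s ]
      upper i with f i in eq | f≤b i
      ... | [ r , 0≤r ] | _ = [ proj₁ (proj₂ lub) r (inj₂ (i , 0≤r , eq)) ]≤
      ... | ⊤⁺          | ()

      lower : ∀ t → (∀ i → f i ≤∞ t) → [ s , 0≤s ] ≤∞ t
      lower ⊤⁺    _ = _ ≤⊤⁺
      lower [ c ] h = [ proj₂ (proj₂ lub) (proj₁ c) (boundS c h) ]≤

    infimum : ∃ IsInfimum
    infimum with lem {∃₂ λ i r → f i ≡ [ r ]}
    ... | no allInfinite = ⊤⁺ , lower , (λ t _ → t ≤⊤⁺)
      where
      lower : ∀ i → ⊤⁺ ≤∞ f i
      lower i with f i in eq
      ... | [ r ] = contradiction (i , r , eq) allInfinite
      ... | ⊤⁺    = ⊤⁺ ≤⊤⁺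
    ... | yes (i₀ , r₀ , eq₀) = [ s , 0≤s ] , lower , greatest
      where
      S : Carrier → Set
      S t = ∀ i r → f i ≡ [ r ] → t ≤ proj₁ r

      0∈S : S 0#
      0∈S _ (_ , 0≤r) _ = 0≤r

      lub = complete S (0# , 0∈S) (proj₁ r₀ , λ t t∈S → t∈S i₀ r₀ eq₀)
      s   = proj₁ lub
      0≤s = proj₁ (proj₂ lub) 0# 0∈S

      lower : ∀ i → [ s , 0≤s ] ≤∞ f i
      lower i with f i in eq
      ... | ⊤⁺    = _ ≤⊤⁺
      ... | [ r ] = [ proj₂ (proj₂ lub) (proj₁ r) (λ t t∈S → t∈S i r eq) ]≤

      greatest : ∀ t → (∀ i → t ≤∞ f i) → t ≤∞ [ s , 0≤s ]
      greatest ⊤⁺    h with ≡.subst (⊤⁺ ≤∞_) eq₀ (h i₀)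
      ... | ()
      greatest [ t ] h = [ proj₁ (proj₂ lub) (proj₁ t) t∈S ]≤
        where
        t∈S : S (proj₁ t)
        t∈S i r eq with f i | h i | eq
        ... | _ | [ t≤r ]≤ | refl = t≤r

  ⨆ ⨅ : {I : Set} → (I → [0,∞]) → [0,∞]
  ⨆ f = proj₁ (supremum f)
  ⨅ f = proj₁ (infimum f)

  -- Unordered sum of a [0,∞]-valued family over an arbitrary index set:
  -- the supremum of its finite partial sums.
  ∑ : {A : Set} → (A → [0,∞]) → [0,∞]
  ∑ {A} f = ⨆ {∃ λ (as : List A) → Unique as}
              (λ (as , _) → foldr _+∞_ 0∞ (map f as))

------------------------------------------------------------------------
-- Curvature

module Curvature (lem : ExcludedMiddle 0ℓ) (ℛ : CompleteOrderedField)
                 (ℋ : Hypergraph)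
                 (locallyFinite : Hypergraph.LocallyFinite ℋ) where
  open CompleteOrderedField ℛ
  open Extrema lem ℛ
  open Hypergraph ℋ

  star : V → List E
  star x = proj₁ (locallyFinite x)

  degree : V → ℕ
  degree x = length (star x)

  distance : V → V → ℕ ⁺
  distance u v with lem {u ≡ v}
  ... | yes _ = [ 0 ]
  ... | no  _ = minimum λ l →
                  ∃ λ es → IsHyperpath u v es × List⁺.length es ≡ l

  record Coupling (μ₁ μ₂ : V → Carrier) : Set where
    field
      π   : V → V → Carrier
      0≤π : ∀ u v → 0# ≤ π u v
      π≤1 : ∀ u v → π u v ≤ 1#

    π∞ : V → V → [0,∞]
    π∞ u v = [ π u v , 0≤π u v ]

    field
      marginal₁ : ∀ u → ∃ λ m → ∑ (λ w → π∞ u w) ≈∞ [ m ] × proj₁ m ≈ μ₁ u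
      marginal₂ : ∀ v → ∃ λ m → ∑ (λ w → π∞ w v) ≈∞ [ m ] × proj₁ m ≈ μ₂ v

    cost : [0,∞]
    cost = ∑ λ u → ∑ λ v → distance u v · (π u v , 0≤π u v)

  W₁ : (V → Carrier) → (V → Carrier) → [0,∞]
  W₁ μ₁ μ₂ = ⨅ (Coupling.cost {μ₁} {μ₂})

  μ : Carrier → V → V → Carrier
  μ α x z with lem {z ≡ x} | lem {z ∼ x}
  ... | yes _ | _     = α
  ... | no  _ | yes _ =
    (1# - α) * fromℕ (degree x) ⁻¹ *
    sum (map (λ e → (fromℕ ∣ e ∣ - 1#) ⁻¹)
             (filter (λ e → lem {z ∈ᴱ e}) (star x)))
  ... | no  _ | no  _ = 0#

  -- "κ_α(x,y) is defined and equals c".  A relation rather than a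
  -- function, because 1 - W₁/d is a real number only when W₁ is finite
  -- and d is finite and nonzero.
  IsOllivierRicci : Carrier → V → V → Carrier → Set
  IsOllivierRicci α x y c =
    ∃₂ λ d w → distance x y ≡ [ d ] × d ≢ 0 ×
               W₁ (μ α x) (μ α y) ≈∞ [ w ] ×
               c ≈ 1# - proj₁ w * fromℕ d ⁻¹

  -- "κ_LLY(x,y) exists and equals k": the one-sided limit of
  -- κ_α(x,y) / (1 - α) as α ↑ 1.
  IsLinLuYau : V → V → Carrier → Set
  IsLinLuYau x y k =
    ∀ ε → 0# < ε → ∃ λ δ → 0# < δ ×
      (∀ α → 0# ≤ α → 1# - δ < α → α < 1# →
        ∃ λ c → IsOllivierRicci α x y c ×
                - ε < c * (1# - α) ⁻¹ - k × c * (1# - α) ⁻¹ - k < ε)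

{-# OPTIONS --safe #-}

-- Since d(x,y) = 1, both claims say that for α ≤ β < 1 the optimal cost W(α)
-- satisfies W(β) = θ W(α) + (1 - θ), where θ = (1 - β) / (1 - α).  As μ^β is the
-- mixture θ μ^α + (1 - θ) δ, the inequality ≤ follows by mixing a plan with the
-- unit transport from x to y.  Conversely, a plan at β that moves at least 1 - θ
-- from x to y arises by such a mixing, so it suffices to reach 1 - θ at no cost.
--
-- If α ≥ 1/2 every plan moves that much, because x holds mass β while μ_y^β has
-- only 1 - β outside y.  In the linear uniform case, say with d_x ≤ d_y, let x
-- send mass to z ≠ y.  If d(x,z) ≥ 2, the transports x → z, u → y can be
-- exchanged for x → y, u → z.  Otherwise μ_x(z) ≥ μ_y(z), so z passes on at least
-- what it receives, and x → z → w, u → y can be exchanged for x → y, u → w.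
-- Neither exchange raises the cost.

module Submission where

open import Defs
open import Algebra.Bundles using (CommutativeRing; RawRing)
import Algebra.Properties.Ring as RingProperties
import Algebra.Properties.Semiring.Mult as SemiringMult
import Algebra.Solver.Ring as RingSolver
open import Algebra.Solver.Ring.AlmostCommutativeRing using (fromCommutativeRing; _-Raw-AlmostCommutative⟶_)
import Algebra.Solver.Ring.NaturalCoefficients.Default as NaturalCoefficients
open import Axiom.ExcludedMiddle using (ExcludedMiddle)
open import Data.List.Base
  using (List; []; _∷_; map; foldr; filter; length; _++_; concatMap; deduplicate; initLast; _∷ʳ′_)
open import Data.List.Membership.Propositional using (_∈_; _∉_; find; lose)
open import Data.List.Membership.Propositional.Properties
  using (∈-deduplicate⁺; ∈-deduplicate⁻; ∈-concatMap⁺; ∈-concatMap⁻; ∈-++⁺ˡ; ∈-++⁺ʳ; ∈-++⁻)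
open import Data.List.NonEmpty.Base as List⁺ using (List⁺; _∷_)
open import Data.List.Relation.Unary.All as All using ([]; _∷_)
open import Data.List.Relation.Unary.AllPairs using ([]; _∷_)
open import Data.List.Relation.Unary.Any using (here; there)
open import Data.List.Relation.Unary.Linked using ([-]; _∷_)
import Data.List.Relation.Unary.Unique.DecPropositional.Properties as UniqueDec
open import Data.List.Relation.Unary.Unique.Propositional using (Unique)
open import Data.Maybe.Base using (Maybe; just; nothing)
open import Data.Nat.Base as ℕ using (ℕ; suc; s≤s; z≤n)
import Data.Nat.Properties as ℕₚ
open import Data.Product.Base using (∃; _×_; _,_; proj₁; proj₂)
open import Data.Sum.Base using (_⊎_; inj₁; inj₂)
open import Function.Bundles using (Equivalence)
open import Level using (0ℓ)
open import Relation.Binary.Bundles using (Poset)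
import Relation.Binary.Construct.Add.Point.Equality as PointEquality
open import Relation.Binary.Definitions using (DecidableEquality)
open import Relation.Binary.PropositionalEquality as ≡ using (_≡_; _≢_)
import Relation.Binary.Reasoning.PartialOrder as PartialOrderReasoning
import Relation.Binary.Reasoning.Setoid as ≈-Reasoning
open import Relation.Binary.Structures using (IsTotalOrder)
open import Relation.Nullary using (Dec; yes; no; ¬_; contradiction)
open import Relation.Nullary.Construct.Add.Supremum using (_⁺; [_]; ⊤⁺)

-- Ordered fields

-- The threshold in the linear uniform case comes from a count at `x`. At most μ_y^β(x) of the mass
-- of `x` can stay there, so 1 - θ can be put on x → y as soon as 1 - θ ≤ β - (1 - β) ν, where ν is
-- the share that the walk without idleness gives from y to x. Since 1 - β = θ (1 - α), dividing by
-- θ leaves (1 - α)(1 + ν) ≤ 1, free of β. With ν = 1 / (d_y (r - 1)) this reads α ≥ 1 / (d_y (r -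
-- 1) + 1). The choice d_x ≤ d_y thus serves twice: it makes the common neighbours heavy at `x`, and
-- it turns d_y into the maximum. Masses are real numbers and a plan spreads them over many
-- vertices, so the exchanges cannot be made one at a time. They are made all at once, with shares
-- chosen proportionally, by adding one matrix to the plan and subtracting another with the same
-- marginals. No optimal plan is used: every plan is improved on its own, and infima are compared
-- through their lower bounds. The limit needs no analysis: the scaled curvature at 1/2 is taken as
-- its value, and the quotient is constant from there on.

module OrderedField (ℛ : CompleteOrderedField) where
  open CompleteOrderedField ℛ public hiding (ring)
  open CommutativeRing commutativeRing public
    using (ring; semiring; setoid; +-cong; +-congˡ; +-congʳ; *-cong; *-congˡ; *-congʳ; -‿cong
          ; +-comm; +-assoc; +-identityˡ; *-comm; *-assoc; *-identityˡ; *-identityʳ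
          ; zeroˡ; zeroʳ; distribˡ; distribʳ; -‿inverseʳ)
    renaming (reflexive to ≈-reflexive)
  open IsTotalOrder isTotalOrder public using (isPartialOrder)

  ≤-poset : Poset 0ℓ 0ℓ 0ℓ
  ≤-poset = record { isPartialOrder = isPartialOrder }

  module ≤-Reasoning = PartialOrderReasoning ≤-poset

  -- A ring solver with integer coefficients.

  module Solver where
    open SemiringMult semiring using (×-homo-+; ×1-homo-*)

    -- A coefficient (m , n) stands for the integer m - n.
    coefficients : RawRing 0ℓ 0ℓ
    coefficients = record
      { Carrier = ℕ × ℕ
      ; _≈_ = _≡_
      ; _+_ = λ (a , b) (c , d) → a ℕ.+ c , b ℕ.+ d
      ; _*_ = λ (a , b) (c , d) → a ℕ.* c ℕ.+ b ℕ.* d , a ℕ.* d ℕ.+ b ℕ.* c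
      ; -_  = λ (a , b) → b , a
      ; 0#  = 0 , 0
      ; 1#  = 1 , 0
      }

    open RingProperties ring using (-‿+-comm; -0#≈0#; -‿involutive; -‿distribˡ-*; -‿distribʳ-*; +-cancelʳ)

    -- Bootstraps the ring solver: the laws of the integer coefficients are themselves proved by
    -- semiring normalisation, with negated terms as atoms.
    module ℕSolver = NaturalCoefficients (CommutativeRing.commutativeSemiring commutativeRing)

    value : ℕ × ℕ → Carrier
    value (m , n) = fromℕ m - fromℕ n

    -- Equal integers must have definitionally equal interpretations, and 0 and
    -- 1 must be interpreted by 0# and 1# themselves, for the solver to see
    -- the constants of a goal.
    interpret : ℕ × ℕ → Carrier
    interpret (suc m , suc n) = interpret (m , n)
    interpret (0     , 0)     = 0#
    interpret (0     , suc n) = - fromℕ (suc n)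
    interpret (1     , 0)     = 1#
    interpret (suc m , 0)     = fromℕ (suc m)

    interpret≈value : ∀ p → interpret p ≈ value p
    interpret≈value (suc m , suc n) = ≈-trans (interpret≈value (m , n)) (≈-sym (begin
      (1# + fromℕ m) - (1# + fromℕ n)        ≈⟨ +-congˡ (-‿+-comm 1# (fromℕ n)) ⟨
      (1# + fromℕ m) + (- 1# + - fromℕ n)    ≈⟨ ℕSolver.solve 4 (λ a b c d →
        (a :+ b) :+ (c :+ d) := (a :+ c) :+ (b :+ d)) ≈-refl 1# (fromℕ m) (- 1#) (- fromℕ n) ⟩
      (1# - 1#) + (fromℕ m - fromℕ n)        ≈⟨ +-congʳ (-‿inverseʳ 1#) ⟩
      0# + (fromℕ m - fromℕ n)               ≈⟨ +-identityˡ _ ⟩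
      fromℕ m - fromℕ n                      ∎))
      where
      open ≈-Reasoning setoid
      open ℕSolver using (_:+_; _:=_)
    interpret≈value (0           , 0)     = ≈-sym (-‿inverseʳ 0#)
    interpret≈value (0           , suc n) = ≈-sym (+-identityˡ _)
    interpret≈value (1           , 0)     =
      ≈-sym (≈-trans (+-cong (+-identityʳ 1#) -0#≈0#) (+-identityʳ 1#))
    interpret≈value (suc (suc m) , 0)     = ≈-sym (≈-trans (+-congˡ -0#≈0#) (+-identityʳ _))

    +-homo : ∀ p q → value (RawRing._+_ coefficients p q) ≈ value p + value q
    +-homo (a , b) (c , d) = ≈-trans
      (+-cong (×-homo-+ 1# a c)
              (≈-trans (-‿cong (×-homo-+ 1# b d)) (≈-sym (-‿+-comm (fromℕ b) (fromℕ d)))))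
      (ℕSolver.solve 4 (λ a c b d → (a :+ c) :+ (b :+ d) := (a :+ b) :+ (c :+ d)) ≈-refl
         (fromℕ a) (fromℕ c) (- fromℕ b) (- fromℕ d))
      where open ℕSolver using (_:+_; _:=_)

    *-homo : ∀ p q → value (RawRing._*_ coefficients p q) ≈ value p * value q
    *-homo (a , b) (c , d) = begin
      fromℕ (a ℕ.* c ℕ.+ b ℕ.* d) - fromℕ (a ℕ.* d ℕ.+ b ℕ.* c)
        ≈⟨ +-cong (product-sum a c b d)
             (≈-trans (-‿cong (product-sum a d b c)) (≈-sym (-‿+-comm _ _))) ⟩
      (A * C + B * D) + (- (A * D) + - (B * C))
        ≈⟨ +-cong (+-congˡ (≈-sym (-‿involutive _))) (+-congʳ (-‿distribʳ-* A D)) ⟩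
      (A * C + - - (B * D)) + (A * - D + - (B * C))
        ≈⟨ +-cong (+-congˡ (≈-trans (-‿cong (-‿distribʳ-* B D)) (-‿distribˡ-* B (- D))))
                  (+-congˡ (-‿distribˡ-* B C)) ⟩
      (A * C + - B * - D) + (A * - D + - B * C)
        ≈⟨ ℕSolver.solve 4 (λ a b c d → (a :* c :+ b :* d) :+ (a :* d :+ b :* c)
                                        := (a :+ b) :* (c :+ d)) ≈-refl A (- B) C (- D) ⟩
      (A - B) * (C - D) ∎
      where
      open ≈-Reasoning setoid
      open ℕSolver using (_:+_; _:*_; _:=_)
      A = fromℕ a
      B = fromℕ b
      C = fromℕ c
      D = fromℕ d

      product-sum : ∀ k l m n → fromℕ (k ℕ.* l ℕ.+ m ℕ.* n) ≈ fromℕ k * fromℕ l + fromℕ m * fromℕ n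
      product-sum k l m n = ≈-trans (×-homo-+ 1# (k ℕ.* l) (m ℕ.* n)) (+-cong (×1-homo-* k l) (×1-homo-* m n))

    morphism : coefficients -Raw-AlmostCommutative⟶ fromCommutativeRing commutativeRing
    morphism = record
      { ⟦_⟧    = interpret
      ; +-homo =
          λ p q → homo₂ (RawRing._+_ coefficients p q) (+-homo p q) (+-cong (interpret≈value p) (interpret≈value q))
      ; *-homo =
          λ p q → homo₂ (RawRing._*_ coefficients p q) (*-homo p q) (*-cong (interpret≈value p) (interpret≈value q))
      ; -‿homo = λ p → ≈-trans (interpret≈value (proj₂ p , proj₁ p))
                   (≈-trans (-‿homo p) (-‿cong (≈-sym (interpret≈value p))))
      ; 0-homo = ≈-refl
      ; 1-homo = ≈-refl
      }
      where
      homo₂ : ∀ r {x y} → value r ≈ x → y ≈ x → interpret r ≈ y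
      homo₂ r r≈x y≈x = ≈-trans (interpret≈value r) (≈-trans r≈x (≈-sym y≈x))

      -‿homo : ∀ p → value (proj₂ p , proj₁ p) ≈ - value p
      -‿homo (a , b) = ≈-sym (≈-trans (≈-sym (-‿+-comm (fromℕ a) (- fromℕ b)))
        (≈-trans (+-congˡ (-‿involutive (fromℕ b))) (+-comm _ _)))

    sameInteger? : ∀ p q → Maybe (interpret p ≈ interpret q)
    sameInteger? p@(a , b) q@(c , d) with a ℕ.+ d ℕₚ.≟ c ℕ.+ b
    ... | no  _  = nothing
    ... | yes eq = just (≈-trans (interpret≈value p) (≈-trans (+-cancelʳ (fromℕ b + fromℕ d) _ _ (begin
      (A - B) + (B + D)  ≈⟨ cancel A B D ⟩
      A + D              ≈⟨ ×-homo-+ 1# a d ⟨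
      fromℕ (a ℕ.+ d)    ≡⟨ ≡.cong fromℕ eq ⟩
      fromℕ (c ℕ.+ b)    ≈⟨ ×-homo-+ 1# c b ⟩
      C + B              ≈⟨ cancel C D B ⟨
      (C - D) + (D + B)  ≈⟨ +-congˡ (+-comm D B) ⟩
      (C - D) + (B + D)  ∎)) (≈-sym (interpret≈value q))))
      where
      open ≈-Reasoning setoid
      A = fromℕ a
      B = fromℕ b
      C = fromℕ c
      D = fromℕ d

      cancel : ∀ x y z → (x - y) + (y + z) ≈ x + z
      cancel x y z = begin
        (x - y) + (y + z)    ≈⟨ +-assoc x (- y) (y + z) ⟩
        x + (- y + (y + z))  ≈⟨ +-congˡ (+-assoc (- y) y z) ⟨
        x + ((- y + y) + z)  ≈⟨ +-congˡ (+-congʳ (-‿inverseˡ y)) ⟩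
        x + (0# + z)         ≈⟨ +-congˡ (+-identityˡ z) ⟩
        x + z                ∎

    open RingSolver coefficients (fromCommutativeRing commutativeRing) morphism sameInteger? public

    :0 :1 : ∀ {n} → Polynomial n
    :0 = con (0 , 0)
    :1 = con (1 , 0)

  open Solver using (solve; _:+_; _:*_; _:-_; _:=_; :0; :1)

  -- Turns an inequality into a ring identity for the solver, once the difference of the two sides
  -- is exhibited as something nonnegative.
  ≤-slack : ∀ {a b} d → 0# ≤ d → b ≈ a + d → a ≤ b
  ≤-slack {a} {b} d 0≤d b≈a+d =
    ≤-respˡ-≈ (+-identityʳ a) (≤-respʳ-≈ (≈-sym b≈a+d) (+-monoʳ-≤ a 0≤d))

  a≤b⇒0≤b-a : ∀ {a b} → a ≤ b → 0# ≤ b - a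
  a≤b⇒0≤b-a {a} {b} a≤b =
    ≤-respˡ-≈ (-‿inverseˡ a) (≤-respʳ-≈ (+-comm (- a) b) (+-monoʳ-≤ (- a) a≤b))

  +-mono-≤ : ∀ {a b c d} → a ≤ b → c ≤ d → a + c ≤ b + d
  +-mono-≤ {a} {b} {c} {d} a≤b c≤d =
    ≤-slack ((b - a) + (d - c)) (+-nonNegative (a≤b⇒0≤b-a a≤b) (a≤b⇒0≤b-a c≤d))
      (solve 4 (λ a b c d → b :+ d := (a :+ c) :+ ((b :- a) :+ (d :- c))) ≈-refl a b c d)

  *-monoˡ-≤ : ∀ {a b} c → 0# ≤ c → a ≤ b → c * a ≤ c * b
  *-monoˡ-≤ {a} {b} c 0≤c a≤b = ≤-slack (c * (b - a)) (*-nonNegative 0≤c (a≤b⇒0≤b-a a≤b))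
    (solve 3 (λ a b c → c :* b := c :* a :+ c :* (b :- a)) ≈-refl a b c)

  *-monoʳ-≤ : ∀ {a b} c → 0# ≤ c → a ≤ b → a * c ≤ b * c
  *-monoʳ-≤ {a} {b} c 0≤c a≤b =
    ≤-respˡ-≈ (*-comm c a) (≤-respʳ-≈ (*-comm c b) (*-monoˡ-≤ c 0≤c a≤b))

  squeeze : ∀ {a b} → 0# ≤ a → a ≤ b → b ≈ 0# → a ≈ 0#
  squeeze 0≤a a≤b b≈0 = antisym (≤-respʳ-≈ b≈0 a≤b) 0≤a

  0<x⇒x≉0 : ∀ {x} → 0# < x → ¬ x ≈ 0#
  0<x⇒x≉0 (_ , 0≉x) x≈0 = 0≉x (≈-sym x≈0)

  a<b⇒0<b-a : ∀ {a b} → a < b → 0# < b - a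
  a<b⇒0<b-a {a} {b} (a≤b , a≉b) = a≤b⇒0≤b-a a≤b , λ 0≈b-a → a≉b (≈-trans (≈-sym (+-identityʳ a))
    (≈-trans (+-congˡ 0≈b-a) (solve 2 (λ a b → a :+ (b :- a) := b) ≈-refl a b)))

  <-respˡ-≈ : ∀ {a b c} → a ≈ b → a < c → b < c
  <-respˡ-≈ a≈b (a≤c , a≉c) = ≤-respˡ-≈ a≈b a≤c , λ b≈c → a≉c (≈-trans a≈b b≈c)

  <-respʳ-≈ : ∀ {a b c} → a ≈ b → c < a → c < b
  <-respʳ-≈ a≈b (c≤a , c≉a) = ≤-respʳ-≈ a≈b c≤a , λ c≈b → c≉a (≈-trans c≈b (≈-sym a≈b))

  0<x⇒-x<0 : ∀ {x} → 0# < x → - x < 0#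
  0<x⇒-x<0 {x} (0≤x , 0≉x) = ≤-slack x 0≤x (≈-sym (-‿inverseˡ x)) , λ -x≈0 →
    0≉x (≈-trans (≈-sym (-‿inverseˡ x)) (≈-trans (+-congʳ -x≈0) (+-identityˡ x)))

  1≰0 : ¬ 1# ≤ 0#
  1≰0 1≤0 = 0≉1 (antisym 0≤1 1≤0)

  0<x+1 : ∀ {x} → 0# ≤ x → 0# < x + 1#
  0<x+1 {x} 0≤x = +-nonNegative 0≤x 0≤1 , λ 0≈x+1 →
    1≰0 (≤-slack x 0≤x (≈-trans 0≈x+1 (+-comm x 1#)))

  0≤x⁻¹ : ∀ {x} → 0# < x → 0# ≤ x ⁻¹
  0≤x⁻¹ {x} 0<x with total 0# (x ⁻¹)
  ... | inj₁ 0≤x⁻¹ = 0≤x⁻¹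
  ... | inj₂ x⁻¹≤0 = contradiction
    (≤-respˡ-≈ (*-inverseʳ x (0<x⇒x≉0 0<x)) (≤-respʳ-≈ (zeroʳ x) (*-monoˡ-≤ x (proj₁ 0<x) x⁻¹≤0))) 1≰0

  *-cancelˡ-≤ : ∀ {a b} c → 0# < c → c * a ≤ c * b → a ≤ b
  *-cancelˡ-≤ {a} {b} c 0<c ca≤cb =
    ≤-respˡ-≈ (reduce a) (≤-respʳ-≈ (reduce b) (*-monoˡ-≤ (c ⁻¹) (0≤x⁻¹ 0<c) ca≤cb))
    where
    reduce : ∀ d → c ⁻¹ * (c * d) ≈ d
    reduce d = ≈-trans (solve 3 (λ i c d → i :* (c :* d) := (c :* i) :* d) ≈-refl (c ⁻¹) c d)
      (≈-trans (*-congʳ (*-inverseʳ c (0<x⇒x≉0 0<c))) (*-identityˡ d))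

  0<fromℕ[1+n] : ∀ n → 0# < fromℕ (suc n)
  0<fromℕ[1+n] n = let 0≤ , 0≉ = 0<x+1 (0≤fromℕ n) in
    ≤-respʳ-≈ (+-comm _ 1#) 0≤ , λ 0≈ → 0≉ (≈-trans 0≈ (+-comm 1# _))

  fromℕ-mono-≤ : ∀ {m n} → m ℕ.≤ n → fromℕ m ≤ fromℕ n
  fromℕ-mono-≤ {n = n} ℕ.z≤n = 0≤fromℕ n
  fromℕ-mono-≤ (ℕ.s≤s m≤n)   = +-monoʳ-≤ 1# (fromℕ-mono-≤ m≤n)

  ⁻¹-antimono : ∀ {a b} → 0# < a → 0# < b → a ≤ b → b ⁻¹ ≤ a ⁻¹
  ⁻¹-antimono {a} {b} 0<a 0<b a≤b = begin
    b ⁻¹                  ≈⟨ *-identityʳ _ ⟨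
    b ⁻¹ * 1#             ≈⟨ *-congˡ (*-inverseʳ a (0<x⇒x≉0 0<a)) ⟨
    b ⁻¹ * (a * a ⁻¹)     ≤⟨ *-monoˡ-≤ (b ⁻¹) (0≤x⁻¹ 0<b) (*-monoʳ-≤ (a ⁻¹) (0≤x⁻¹ 0<a) a≤b) ⟩
    b ⁻¹ * (b * a ⁻¹)     ≈⟨ solve 3 (λ i b j → i :* (b :* j) := (b :* i) :* j) ≈-refl (b ⁻¹) b (a ⁻¹) ⟩
    (b * b ⁻¹) * a ⁻¹     ≈⟨ *-congʳ (*-inverseʳ b (0<x⇒x≉0 0<b)) ⟩
    1# * a ⁻¹             ≈⟨ *-identityˡ _ ⟩
    a ⁻¹                  ∎
    where open ≤-Reasoning

  ½+½≈1 : ½ + ½ ≈ 1#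
  ½+½≈1 = ≈-trans (solve 1 (λ h → h :+ h := (:1 :+ (:1 :+ :0)) :* h) ≈-refl ½)
    (*-inverseʳ (fromℕ 2) (0<x⇒x≉0 (0<fromℕ[1+n] 1)))

  0<½ : 0# < ½
  0<½ = 0≤x⁻¹ (0<fromℕ[1+n] 1) , λ 0≈½ →
    0≉1 (≈-trans (≈-sym (+-identityˡ 0#)) (≈-trans (+-cong 0≈½ 0≈½) ½+½≈1))

  1-½≈½ : 1# - ½ ≈ ½
  1-½≈½ = ≈-trans (+-congʳ (≈-sym ½+½≈1)) (solve 1 (λ h → (h :+ h) :- h := h) ≈-refl ½)

  ½<1 : ½ < 1#
  ½<1 = ≤-slack ½ (proj₁ 0<½) (≈-sym ½+½≈1) , λ ½≈1 →
    proj₂ 0<½ (≈-trans (≈-sym (-‿inverseʳ 1#)) (≈-trans (+-congˡ (-‿cong (≈-sym ½≈1))) 1-½≈½))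

-- Finite sums

module FiniteSums (lem : ExcludedMiddle 0ℓ) (ℛ : CompleteOrderedField) where
  open OrderedField ℛ
  open Solver using (solve; _:+_; _:*_; _:-_; _:=_; :0; :1)

  module _ {A : Set} where

    S : List A → (A → Carrier) → Carrier
    S L f = sum (map f L)

    S-cong : ∀ L {f g} → (∀ a → a ∈ L → f a ≈ g a) → S L f ≈ S L g
    S-cong []      f≈g = ≈-refl
    S-cong (a ∷ L) f≈g = +-cong (f≈g a (here ≡.refl)) (S-cong L λ b b∈L → f≈g b (there b∈L))

    S-mono : ∀ L {f g} → (∀ a → a ∈ L → f a ≤ g a) → S L f ≤ S L g
    S-mono []      f≤g = ≤-refl
    S-mono (a ∷ L) f≤g = +-mono-≤ (f≤g a (here ≡.refl)) (S-mono L λ b b∈L → f≤g b (there b∈L))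

    S-zero : ∀ L → S L (λ _ → 0#) ≈ 0#
    S-zero []      = ≈-refl
    S-zero (a ∷ L) = ≈-trans (+-identityˡ _) (S-zero L)

    S-one : ∀ L → S L (λ _ → 1#) ≈ fromℕ (length L)
    S-one []      = ≈-refl
    S-one (a ∷ L) = +-congˡ (S-one L)

    S-nonNegative : ∀ L {f} → (∀ a → a ∈ L → 0# ≤ f a) → 0# ≤ S L f
    S-nonNegative L 0≤f = ≤-respˡ-≈ (S-zero L) (S-mono L 0≤f)

    S-+ : ∀ L f g → S L (λ a → f a + g a) ≈ S L f + S L g
    S-+ []      f g = ≈-sym (+-identityˡ 0#)
    S-+ (a ∷ L) f g = ≈-trans (+-congˡ (S-+ L f g))
      (solve 4 (λ a b c d → (a :+ b) :+ (c :+ d) := (a :+ c) :+ (b :+ d)) ≈-refl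
        (f a) (g a) (S L f) (S L g))

    S-*ˡ : ∀ L c f → S L (λ a → c * f a) ≈ c * S L f
    S-*ˡ []      c f = ≈-sym (zeroʳ c)
    S-*ˡ (a ∷ L) c f = ≈-trans (+-congˡ (S-*ˡ L c f)) (≈-sym (distribˡ c (f a) (S L f)))

    S-*ʳ : ∀ L c f → S L (λ a → f a * c) ≈ S L f * c
    S-*ʳ L c f = ≈-trans (S-cong L λ a _ → *-comm (f a) c) (≈-trans (S-*ˡ L c f) (*-comm c _))

    S-minus : ∀ L f g → S L (λ a → f a - g a) ≈ S L f - S L g
    S-minus []      f g = ≈-sym (-‿inverseʳ 0#)
    S-minus (a ∷ L) f g = ≈-trans (+-congˡ (S-minus L f g))
      (solve 4 (λ a b c d → (a :- b) :+ (c :- d) := (a :+ c) :- (b :+ d)) ≈-refl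
        (f a) (g a) (S L f) (S L g))

    term≤S : ∀ {L f a} → (∀ b → b ∈ L → 0# ≤ f b) → a ∈ L → f a ≤ S L f
    term≤S {a ∷ L} {f} 0≤f (here ≡.refl) =
      ≤-slack (S L f) (S-nonNegative L λ b b∈L → 0≤f b (there b∈L)) ≈-refl
    term≤S {b ∷ L} {f} 0≤f (there a∈L) = ≤-trans (term≤S (λ c c∈L → 0≤f c (there c∈L)) a∈L)
      (≤-slack (f b) (0≤f b (here ≡.refl)) (+-comm _ _))

    S≈0⇒term≈0 : ∀ {L f} → (∀ b → b ∈ L → 0# ≤ f b) → S L f ≈ 0# → ∀ a → a ∈ L → f a ≈ 0#
    S≈0⇒term≈0 0≤f Sf≈0 a a∈L = antisym (≤-respʳ-≈ Sf≈0 (term≤S 0≤f a∈L)) (0≤f a a∈L)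

    δ : A → A → Carrier
    δ a b with lem {a ≡ b}
    ... | yes _ = 1#
    ... | no  _ = 0#

    δ-refl : ∀ a → δ a a ≈ 1#
    δ-refl a with lem {a ≡ a}
    ... | yes _   = ≈-refl
    ... | no  a≢a = contradiction ≡.refl a≢a

    δ-≢ : ∀ {a b} → a ≢ b → δ a b ≈ 0#
    δ-≢ {a} {b} a≢b with lem {a ≡ b}
    ... | yes a≡b = contradiction a≡b a≢b
    ... | no  _   = ≈-refl

    δ-sym : ∀ a b → δ a b ≈ δ b a
    δ-sym a b with lem {a ≡ b} | lem {b ≡ a}
    ... | yes _   | yes _   = ≈-refl
    ... | yes a≡b | no  b≢a = contradiction (≡.sym a≡b) b≢a
    ... | no  a≢b | yes b≡a = contradiction (≡.sym b≡a) a≢b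
    ... | no  _   | no  _   = ≈-refl

    0≤δ : ∀ a b → 0# ≤ δ a b
    0≤δ a b with lem {a ≡ b}
    ... | yes _ = 0≤1
    ... | no  _ = ≤-refl

    δ*-cong : ∀ a (f : A → Carrier) b → δ a b * f b ≈ δ a b * f a
    δ*-cong a f b with lem {a ≡ b}
    ... | yes ≡.refl = ≈-refl
    ... | no  _      = ≈-trans (zeroˡ _) (≈-sym (zeroˡ _))

    S-δ-∉ : ∀ {L a} → a ∉ L → S L (δ a) ≈ 0#
    S-δ-∉ {L} a∉L = ≈-trans (S-cong L λ b b∈L → δ-≢ λ a≡b → a∉L (≡.subst (_∈ L) (≡.sym a≡b) b∈L)) (S-zero L)

    S-δ : ∀ {L a} → Unique L → a ∈ L → S L (δ a) ≈ 1#
    S-δ {a ∷ L} (a∉L ∷ _) (here ≡.refl) =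
      ≈-trans (+-cong (δ-refl a) (S-δ-∉ λ a∈L → All.lookup a∉L a∈L ≡.refl)) (+-identityʳ 1#)
    S-δ {b ∷ L} (b∉L ∷ uL) (there a∈L) =
      ≈-trans (+-cong (δ-≢ λ a≡b → All.lookup b∉L a∈L (≡.sym a≡b)) (S-δ uL a∈L)) (+-identityˡ 1#)

    S-δ≤1 : ∀ {L} → Unique L → ∀ a → S L (δ a) ≤ 1#
    S-δ≤1 {L} uL a with lem {a ∈ L}
    ... | yes a∈L = ≤-reflexive (S-δ uL a∈L)
    ... | no  a∉L = ≤-respˡ-≈ (≈-sym (S-δ-∉ a∉L)) 0≤1

    S-δ* : ∀ {L a} → Unique L → a ∈ L → ∀ f → S L (λ b → δ a b * f b) ≈ f a
    S-δ* {L} {a} uL a∈L f = ≈-trans (S-cong L λ b _ → δ*-cong a f b)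
      (≈-trans (S-*ʳ L (f a) (δ a)) (≈-trans (*-congʳ (S-δ uL a∈L)) (*-identityˡ (f a))))

  S-swap : ∀ {A B : Set} (L : List A) (M : List B) (f : A → B → Carrier) →
           S L (λ a → S M λ b → f a b) ≈ S M (λ b → S L λ a → f a b)
  S-swap []      M f = ≈-sym (S-zero M)
  S-swap (a ∷ L) M f = ≈-trans (+-congˡ (S-swap L M f)) (≈-sym (S-+ M (f a) (λ b → S L λ a → f a b)))

  module _ {A : Set} where

    -- Each `g a` is the sum of `δ a b * g b` over `M`. After swapping the sums, every `b` in `M` is
    -- counted at most once, because `L` has no repetitions.
    S⊆-≤ : ∀ {L M : List A} {g} → Unique L → Unique M → (∀ a → 0# ≤ g a) →
           (∀ a → a ∉ M → g a ≈ 0#) → S L g ≤ S M g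
    S⊆-≤ {L} {M} {g} uL uM 0≤g g≈0 = begin
      S L g                                  ≈⟨ S-cong L (λ a _ → expand a) ⟩
      S L (λ a → S M λ b → δ a b * g b)      ≈⟨ S-swap L M (λ a b → δ a b * g b) ⟩
      S M (λ b → S L λ a → δ a b * g b)      ≈⟨ S-cong M (λ b _ → S-*ʳ L (g b) (λ a → δ a b)) ⟩
      S M (λ b → S L (λ a → δ a b) * g b)    ≤⟨ S-mono M (λ b _ → *-monoʳ-≤ (g b) (0≤g b)
        (≤-respˡ-≈ (S-cong L λ a _ → δ-sym b a) (S-δ≤1 uL b))) ⟩
      S M (λ b → 1# * g b)                   ≈⟨ S-cong M (λ b _ → *-identityˡ (g b)) ⟩
      S M g                                  ∎
      where
      open ≤-Reasoning
      expand : ∀ a → g a ≈ S M λ b → δ a b * g b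
      expand a with lem {a ∈ M}
      ... | yes a∈M = ≈-sym (S-δ* uM a∈M g)
      ... | no  a∉M = ≈-trans (g≈0 a a∉M) (≈-sym (≈-trans
        (≈-trans (S-cong M λ b _ → δ*-cong a g b) (S-*ʳ M (g a) (δ a)))
        (≈-trans (*-congˡ (g≈0 a a∉M)) (zeroʳ _))))

-- Transport plans

module Transport (lem : ExcludedMiddle 0ℓ) (ℛ : CompleteOrderedField)
                 {V : Set} (L : List V) (L-unique : Unique L) where
  open OrderedField ℛ
  open FiniteSums lem ℛ
  open Solver using (solve; _:+_; _:*_; _:-_; _:=_; :0; :1)

  NonNegative : (V → Carrier) → Set
  NonNegative f = ∀ v → v ∈ L → 0# ≤ f v

  -- The factor `1# - δ x v` keeps erasing linear in `f`, so the total drops by a plain subtraction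
  -- in `S-erase`.
  erase : V → (V → Carrier) → V → Carrier
  erase x f v = (1# - δ x v) * f v

  erase-≢ : ∀ {x v} f → x ≢ v → erase x f v ≈ f v
  erase-≢ f x≢v = ≈-trans (*-congʳ (+-congˡ (-‿cong (δ-≢ x≢v))))
    (solve 1 (λ a → (:1 :- :0) :* a := a) ≈-refl (f _))

  erase-self : ∀ x f → erase x f x ≈ 0#
  erase-self x f = ≈-trans (*-congʳ (+-congˡ (-‿cong (δ-refl x))))
    (solve 1 (λ a → (:1 :- :1) :* a := :0) ≈-refl (f x))

  0≤erase : ∀ x {f} → NonNegative f → NonNegative (erase x f)
  0≤erase x {f} 0≤f v v∈L with lem {x ≡ v}
  ... | yes _ = ≤-reflexive (solve 1 (λ a → :0 := (:1 :- :1) :* a) ≈-refl (f v))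
  ... | no  _ = ≤-respʳ-≈ (solve 1 (λ a → a := (:1 :- :0) :* a) ≈-refl (f v)) (0≤f v v∈L)

  erase≤ : ∀ x {f} → NonNegative f → ∀ v → v ∈ L → erase x f v ≤ f v
  erase≤ x {f} 0≤f v v∈L = ≤-slack (δ x v * f v) (*-nonNegative (0≤δ x v) (0≤f v v∈L))
    (solve 2 (λ d a → a := (:1 :- d) :* a :+ d :* a) ≈-refl (δ x v) (f v))

  S-erase : ∀ {x} → x ∈ L → ∀ f → S L (erase x f) ≈ S L f - f x
  S-erase {x} x∈L f = begin-equality
    S L (erase x f)                    ≈⟨ S-cong L (λ v _ →
      solve 2 (λ d a → (:1 :- d) :* a := a :- d :* a) ≈-refl (δ x v) (f v)) ⟩
    S L (λ v → f v - δ x v * f v)      ≈⟨ S-minus L f _ ⟩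
    S L f - S L (λ v → δ x v * f v)    ≈⟨ +-congˡ (-‿cong (S-δ* L-unique x∈L f)) ⟩
    S L f - f x                        ∎
    where open ≤-Reasoning

  x*[y/x]≈y : ∀ {x} y → ¬ x ≈ 0# → x * (y * x ⁻¹) ≈ y
  x*[y/x]≈y {x} y x≉0 = ≈-trans (solve 3 (λ x y i → x :* (y :* i) := (x :* i) :* y) ≈-refl x y (x ⁻¹))
    (≈-trans (*-congʳ (*-inverseʳ x x≉0)) (*-identityˡ y))

  -- All entries are scaled by the common ratio t / S f, so no order on the vertices has to be
  -- chosen. If the total vanishes, so does `t`.
  select : ∀ {f t} → NonNegative f → 0# ≤ t → t ≤ S L f →
           ∃ λ g → NonNegative g × (∀ v → v ∈ L → g v ≤ f v) × S L g ≈ t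
  select {f} {t} 0≤f 0≤t t≤Sf with lem {S L f ≈ 0#}
  ... | yes Sf≈0 = (λ _ → 0#) , (λ _ _ → ≤-refl) , 0≤f ,
                   ≈-trans (S-zero L) (antisym 0≤t (≤-respʳ-≈ Sf≈0 t≤Sf))
  ... | no  Sf≉0 = (λ v → f v * r) , (λ v v∈L → *-nonNegative (0≤f v v∈L) 0≤r) ,
                   (λ v v∈L → ≤-respʳ-≈ (*-identityʳ (f v)) (*-monoˡ-≤ (f v) (0≤f v v∈L) r≤1)) ,
                   ≈-trans (S-*ʳ L r f) (x*[y/x]≈y t Sf≉0)
    where
    r   = t * S L f ⁻¹
    0<S = S-nonNegative L 0≤f , λ 0≈S → Sf≉0 (≈-sym 0≈S)
    0≤r = *-nonNegative 0≤t (0≤x⁻¹ 0<S)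
    r≤1 : r ≤ 1#
    r≤1 = ≤-respʳ-≈ (*-inverseʳ (S L f) Sf≉0) (*-monoʳ-≤ (S L f ⁻¹) (0≤x⁻¹ 0<S) t≤Sf)

  -- The finite counterpart of a coupling: constraints on `L` only, and real sums in place of sums
  -- in [0,∞].
  record Plan (m n : V → Carrier) : Set where
    field
      mass : V → V → Carrier
      0≤mass : ∀ u v → u ∈ L → v ∈ L → 0# ≤ mass u v
      rows : ∀ u → u ∈ L → S L (mass u) ≈ m u
      cols : ∀ v → v ∈ L → S L (λ u → mass u v) ≈ n v

  open Plan public

  -- The product `f u * h v`, divided by the common total, has the right marginals; if the total is
  -- zero, both functions vanish on `L`.
  couple : ∀ {f h} → NonNegative f → NonNegative h → S L f ≈ S L h → Plan f h
  couple {f} {h} 0≤f 0≤h Sf≈Sh with lem {S L f ≈ 0#}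
  ... | yes Sf≈0 = record
    { mass   = λ _ _ → 0#
    ; 0≤mass = λ _ _ _ _ → ≤-refl
    ; rows   = λ u u∈L → ≈-trans (S-zero L) (≈-sym (S≈0⇒term≈0 0≤f Sf≈0 u u∈L))
    ; cols   = λ v v∈L → ≈-trans (S-zero L) (≈-sym (S≈0⇒term≈0 0≤h (≈-trans (≈-sym Sf≈Sh) Sf≈0) v v∈L))
    }
  ... | no Sf≉0 = record
    { mass   = λ u v → f u * (h v * r)
    ; 0≤mass = λ u v u∈L v∈L → *-nonNegative (0≤f u u∈L) (*-nonNegative (0≤h v v∈L) 0≤r)
    ; rows   = λ u _ → begin-equality
        S L (λ v → f u * (h v * r))   ≈⟨ S-*ˡ L (f u) _ ⟩
        f u * S L (λ v → h v * r)     ≈⟨ *-congˡ (S-*ʳ L r h) ⟩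
        f u * (S L h * r)             ≈⟨ *-congˡ (*-congʳ (≈-sym Sf≈Sh)) ⟩
        f u * (S L f * r)             ≈⟨ *-congˡ (*-inverseʳ (S L f) Sf≉0) ⟩
        f u * 1#                      ≈⟨ *-identityʳ (f u) ⟩
        f u                           ∎
    ; cols   = λ v _ → begin-equality
        S L (λ u → f u * (h v * r))   ≈⟨ S-*ʳ L (h v * r) f ⟩
        S L f * (h v * r)             ≈⟨ x*[y/x]≈y (h v) Sf≉0 ⟩
        h v                           ∎
    }
    where
    open ≤-Reasoning
    r   = S L f ⁻¹
    0≤r = 0≤x⁻¹ (S-nonNegative L 0≤f , λ 0≈S → Sf≉0 (≈-sym 0≈S))

  SS : (V → V → Carrier) → Carrier
  SS f = S L λ u → S L (f u)

  SS-cong : ∀ {f g} → (∀ u v → u ∈ L → v ∈ L → f u v ≈ g u v) → SS f ≈ SS g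
  SS-cong f≈g = S-cong L λ u u∈L → S-cong L λ v → f≈g u v u∈L

  SS-mono : ∀ {f g} → (∀ u v → u ∈ L → v ∈ L → f u v ≤ g u v) → SS f ≤ SS g
  SS-mono f≤g = S-mono L λ u u∈L → S-mono L λ v → f≤g u v u∈L

  SS-+ : ∀ f g → SS (λ u v → f u v + g u v) ≈ SS f + SS g
  SS-+ f g = ≈-trans (S-cong L λ u _ → S-+ L (f u) (g u)) (S-+ L _ _)

  SS-minus : ∀ f g → SS (λ u v → f u v - g u v) ≈ SS f - SS g
  SS-minus f g = ≈-trans (S-cong L λ u _ → S-minus L (f u) (g u)) (S-minus L _ _)

  SS-*ˡ : ∀ c f → SS (λ u v → c * f u v) ≈ c * SS f
  SS-*ˡ c f = ≈-trans (S-cong L λ u _ → S-*ˡ L c (f u)) (S-*ˡ L c _)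

  SS-swap : ∀ f → SS f ≈ SS (λ v u → f u v)
  SS-swap = S-swap L L

  SS-unit : ∀ {x y} → x ∈ L → y ∈ L → ∀ (f : V → V → Carrier) → SS (λ u v → δ x u * (δ y v * f u v)) ≈ f x y
  SS-unit {x} {y} x∈L y∈L f = ≈-trans
    (S-cong L λ u _ → ≈-trans (S-*ˡ L (δ x u) _) (*-congˡ (S-δ* L-unique y∈L (f u))))
    (S-δ* L-unique x∈L (λ u → f u y))

  cost : (V → V → Carrier) → (V → V → Carrier) → Carrier
  cost D p = SS λ u v → D u v * p u v

  -- Equal marginals of `Q` and `R` preserve those of the plan. `R` is bounded by `mass P + Q`
  -- rather than by `mass P` alone, because it may take away mass that `Q` has just supplied.
  exchange : ∀ {m n} (P : Plan m n) (Q R : V → V → Carrier) →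
             (∀ u v → u ∈ L → v ∈ L → R u v ≤ mass P u v + Q u v) →
             (∀ u → u ∈ L → S L (Q u) ≈ S L (R u)) →
             (∀ v → v ∈ L → S L (λ u → Q u v) ≈ S L (λ u → R u v)) →
             Plan m n
  exchange P Q R R≤P+Q rows≈ cols≈ = record
    { mass   = λ u v → (mass P u v + Q u v) - R u v
    ; 0≤mass = λ u v u∈L v∈L → a≤b⇒0≤b-a (R≤P+Q u v u∈L v∈L)
    ; rows   = λ u u∈L → replace (mass P u) (Q u) (R u) (rows P u u∈L) (rows≈ u u∈L)
    ; cols   = λ v v∈L → replace (λ u → mass P u v) (λ u → Q u v) (λ u → R u v) (cols P v v∈L) (cols≈ v v∈L)
    }
    where
    open ≤-Reasoning
    replace : ∀ p q r {c} → S L p ≈ c → S L q ≈ S L r → S L (λ v → (p v + q v) - r v) ≈ c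
    replace p q r {c} Sp≈c Sq≈Sr = begin-equality
      S L (λ v → (p v + q v) - r v)      ≈⟨ S-minus L (λ v → p v + q v) r ⟩
      S L (λ v → p v + q v) - S L r      ≈⟨ +-congʳ (S-+ L p q) ⟩
      (S L p + S L q) - S L r            ≈⟨ +-congʳ (+-cong Sp≈c Sq≈Sr) ⟩
      (c + S L r) - S L r                ≈⟨ solve 2 (λ c r → (c :+ r) :- r := c) ≈-refl c (S L r) ⟩
      c                                  ∎

  cost-exchange : ∀ D p q r → cost D q ≤ cost D r → cost D (λ u v → (p u v + q u v) - r u v) ≤ cost D p
  cost-exchange D p q r q≤r = begin
    cost D (λ u v → (p u v + q u v) - r u v)
      ≈⟨ SS-cong (λ u v _ _ → solve 4 (λ d p q r → d :* ((p :+ q) :- r) := (d :* p :+ d :* q) :- d :* r)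
           ≈-refl (D u v) (p u v) (q u v) (r u v)) ⟩
    SS (λ u v → (D u v * p u v + D u v * q u v) - D u v * r u v)
      ≈⟨ SS-minus _ _ ⟩
    SS (λ u v → D u v * p u v + D u v * q u v) - cost D r
      ≈⟨ +-congʳ (SS-+ _ _) ⟩
    (cost D p + cost D q) - cost D r
      ≤⟨ ≤-slack (cost D r - cost D q) (a≤b⇒0≤b-a q≤r)
           (solve 3 (λ p q r → p := ((p :+ q) :- r) :+ (r :- q)) ≈-refl (cost D p) (cost D q) (cost D r)) ⟩
    cost D p ∎
    where open ≤-Reasoning

  -- Excluded middle decides membership, so a choice made on L extends to V.
  choose : {B : Set} (b₀ : B) {Q : V → B → Set} → (∀ v → v ∈ L → ∃ (Q v)) →
           ∃ λ (F : V → B) → ∀ v → v ∈ L → Q v (F v)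
  choose {B} b₀ {Q} h = F , F-spec
    where
    F : V → B
    F v with lem {v ∈ L}
    ... | yes v∈L = proj₁ (h v v∈L)
    ... | no  _   = b₀

    F-spec : ∀ v → v ∈ L → Q v (F v)
    F-spec v v∈L with lem {v ∈ L}
    ... | yes v∈L′ = proj₂ (h v v∈L′)
    ... | no  v∉L  = contradiction v∈L v∉L

-- Forcing mass onto the transport from x to y without raising the cost.

module Rerouting (lem : ExcludedMiddle 0ℓ) (ℛ : CompleteOrderedField)
                 {V : Set} (L : List V) (L-unique : Unique L) where
  open OrderedField ℛ
  open FiniteSums lem ℛ
  open Solver using (solve; _:+_; _:*_; _:-_; _:=_; :0; :1)
  open Transport lem ℛ L L-unique

  -- Each bound supplies one ingredient of the exchange. `t≤mx-nx` provides outflow of `x` to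
  -- reroute, and `t≤ny` provides inflow of `y` to divert. `far⊎heavy` makes every abandoned route
  -- from `x` have length at least 2, and `zero⊎near` lets a transport into `y` be diverted at an
  -- extra cost of at most 1.
  module Reroute
    (D : V → V → Carrier)
    (D-diagonal : ∀ v → D v v ≈ 0#)
    (1≤D : ∀ {u v} → u ≢ v → 1# ≤ D u v)
    {x y : V} (x∈L : x ∈ L) (y∈L : y ∈ L) (x≢y : x ≢ y)
    (Dxy≈1 : D x y ≈ 1#)
    {m n : V → Carrier}
    (far⊎heavy : ∀ z → z ≢ x → z ≢ y → 1# + 1# ≤ D x z ⊎ n z ≤ m z)
    (zero⊎near : ∀ w → n w ≈ 0# ⊎ (∀ u → D u w ≤ D u y + 1#))
    (t : Carrier) (t≤ny : t ≤ n y) (t≤mx-nx : t ≤ m x - n x)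
    (P : Plan m n) (Pxy≤t : mass P x y ≤ t)
    where

    private
      p = mass P

    0≤D : ∀ u v → 0# ≤ D u v
    0≤D u v with lem {u ≡ v}
    ... | yes ≡.refl = ≤-reflexive (≈-sym (D-diagonal u))
    ... | no  u≢v    = ≤-trans 0≤1 (1≤D u≢v)

    0≤row : ∀ u → u ∈ L → NonNegative (p u)
    0≤row u u∈L v v∈L = 0≤mass P u v u∈L v∈L

    0≤col : ∀ v → v ∈ L → NonNegative (λ u → p u v)
    0≤col v v∈L u u∈L = 0≤mass P u v u∈L v∈L

    s = t - p x y

    0≤s : 0# ≤ s
    0≤s = a≤b⇒0≤b-a Pxy≤t

    src : V → Carrier
    src = erase y (erase x (p x))

    0≤src : NonNegative src
    0≤src = 0≤erase y (0≤erase x (0≤row x x∈L))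

    -- The entry `p x x` is part of column `x`, hence at most `n x`. So at least `m x - n x` leaves
    -- `x`, and what does not go to `y` covers the deficit `s`.
    s≤S-src : s ≤ S L src
    s≤S-src = begin
      t - p x y                              ≤⟨ ≤-slack ((m x - n x - t) + (n x - p x x))
        (+-nonNegative (a≤b⇒0≤b-a t≤mx-nx) (a≤b⇒0≤b-a (≤-respʳ-≈ (cols P x x∈L) (term≤S (0≤col x x∈L) x∈L))))
        (solve 5 (λ m a b t n → (m :- a) :- b := (t :- b) :+ ((m :- n :- t) :+ (n :- a)))
             ≈-refl (m x) (p x x) (p x y) t (n x)) ⟩
      (m x - p x x) - p x y                  ≈⟨ +-cong (+-congʳ (rows P x x∈L)) (-‿cong (erase-≢ (p x) x≢y)) ⟨
      (S L (p x) - p x x) - erase x (p x) y  ≈⟨ +-congʳ (S-erase x∈L (p x)) ⟨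
      S L (erase x (p x)) - erase x (p x) y  ≈⟨ S-erase y∈L _ ⟨
      S L src                                ∎
      where open ≤-Reasoning

    rerouted-share : ∃ λ a → NonNegative a × (∀ v → v ∈ L → a v ≤ src v) × S L a ≈ s
    rerouted-share = select 0≤src 0≤s s≤S-src

    module Share (a : V → Carrier) (0≤a : NonNegative a) (a≤src : ∀ v → v ∈ L → a v ≤ src v)
                 (Sa≈s : S L a ≈ s) where

      a≤p : ∀ v → v ∈ L → a v ≤ p x v
      a≤p v v∈L = ≤-trans (a≤src v v∈L) (≤-trans (erase≤ y (0≤erase x (0≤row x x∈L)) v v∈L)
                    (erase≤ x (0≤row x x∈L) v v∈L))

      ax≈0 : a x ≈ 0#
      ax≈0 =
          squeeze (0≤a x x∈L) (≤-trans (a≤src x x∈L) (erase≤ y {erase x (p x)} (0≤erase x (0≤row x x∈L)) x x∈L))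
        (erase-self x (p x))

      ay≈0 : a y ≈ 0#
      ay≈0 = squeeze (0≤a y y∈L) (a≤src y y∈L) (erase-self y (erase x (p x)))

      -- How the mass a z, once kept at z, is taken over from the transports out
      -- of z; a far z is its own continuation.
      record Continuation (z : V) (e : V → Carrier) : Set where
        field
          0≤e  : NonNegative e
          Se≈a : S L e ≈ a z
          e≤   : ∀ w → w ∈ L → e w ≤ p z w + δ z w * a z
          long : ∀ w → w ∈ L → (1# + 1#) * e w ≤ (D x z + D z w) * e w

      -- Where `a z` is zero the empty flow serves; this settles `x` and `y`, at which `a` vanishes,
      -- so that `far⊎heavy` applies to every remaining vertex.
      continuation : ∀ z → z ∈ L → ∃ (Continuation z)
      continuation z z∈L with lem {a z ≈ 0#} | lem {z ≡ x} | lem {z ≡ y}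
      ... | yes az≈0 | _ | _ = (λ _ → 0#) , record
        { 0≤e  = λ _ _ → ≤-refl
        ; Se≈a = ≈-trans (S-zero L) (≈-sym az≈0)
        ; e≤   = λ w w∈L → +-nonNegative (0≤row z z∈L w w∈L) (*-nonNegative (0≤δ z w) (0≤a z z∈L))
        ; long = λ w w∈L → ≤-reflexive (≈-trans (zeroʳ _) (≈-sym (zeroʳ _)))
        }
      ... | no az≉0 | yes ≡.refl | _          = contradiction ax≈0 az≉0
      ... | no az≉0 | no  _      | yes ≡.refl = contradiction ay≈0 az≉0
      ... | no _    | no  z≢x    | no  z≢y with far⊎heavy z z≢x z≢y
      -- Keeping `a z` at `z` and removing it again only cancels the transport x → z; its length
      -- alone already accounts for the required 2.
      ...   | inj₁ far = (λ w → δ z w * a z) , record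
        { 0≤e  = 0≤e
        ; Se≈a = S-δ* L-unique z∈L (λ _ → a z)
        ; e≤   = λ w w∈L → ≤-slack (p z w) (0≤row z z∈L w w∈L) (+-comm _ _)
        ; long = λ w w∈L → *-monoʳ-≤ _ (0≤e w w∈L)
            (≤-trans far (≤-slack (D z w) (0≤D z w) ≈-refl))
        }
        where
        0≤e : NonNegative (λ w → δ z w * a z)
        0≤e w _ = *-nonNegative (0≤δ z w) (0≤a z z∈L)
      ...   | inj₂ nz≤mz = let e , 0≤e , e≤src , Se≈a = select (0≤erase z (0≤row z z∈L)) (0≤a z z∈L) az≤ in
        e , record
        { 0≤e  = 0≤e
        ; Se≈a = Se≈a
        ; e≤   = λ w w∈L → ≤-trans (e≤src w w∈L) (≤-trans (erase≤ z (0≤row z z∈L) w w∈L)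
            (≤-slack _ (*-nonNegative (0≤δ z w) (0≤a z z∈L)) ≈-refl))
        ; long = long 0≤e e≤src
        }
        where
        -- The entry `p z z` belongs to both the row and the column of `z`. Once it is dropped,
        -- `nz≤mz` says that `z` passes on at least what it receives, which includes `a z` from `x`.
        az≤ : a z ≤ S L (erase z (p z))
        az≤ = begin
          a z                            ≤⟨ a≤p z z∈L ⟩
          p x z                          ≈⟨ erase-≢ (λ u → p u z) z≢x ⟨
          erase z (λ u → p u z) x        ≤⟨ term≤S (0≤erase z (0≤col z z∈L)) x∈L ⟩
          S L (erase z (λ u → p u z))    ≈⟨ S-erase z∈L _ ⟩
          S L (λ u → p u z) - p z z      ≈⟨ +-congʳ (cols P z z∈L) ⟩
          n z - p z z                    ≤⟨ +-mono-≤ nz≤mz ≤-refl ⟩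
          m z - p z z                    ≈⟨ +-congʳ (rows P z z∈L) ⟨
          S L (p z) - p z z              ≈⟨ S-erase z∈L _ ⟨
          S L (erase z (p z))            ∎
          where open ≤-Reasoning

        -- For w ≠ z both x → z and z → w have length at least 1. At w = z, where the second length
        -- is zero, `e` vanishes because it was selected from an erased row.
        long : ∀ {e} → NonNegative e → (∀ w → w ∈ L → e w ≤ erase z (p z) w) →
               ∀ w → w ∈ L → (1# + 1#) * e w ≤ (D x z + D z w) * e w
        long {e} 0≤e e≤src w w∈L with lem {z ≡ w}
        ... | no z≢w     = *-monoʳ-≤ (e w) (0≤e w w∈L) (+-mono-≤ (1≤D λ x≡z → z≢x (≡.sym x≡z)) (1≤D z≢w))
        ... | yes ≡.refl = ≤-reflexive (≈-trans (zero _) (≈-sym (zero _)))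
          where
          zero : ∀ c → c * e z ≈ 0#
          zero c = ≈-trans (*-congˡ (squeeze (0≤e z z∈L) (e≤src z z∈L) (erase-self z (p z)))) (zeroʳ c)

      module Continued (e : V → V → Carrier) (e-spec : ∀ z → z ∈ L → Continuation z (e z)) where

        open module E z z∈L = Continuation (e-spec z z∈L)

        -- The distribution of the ends w of the abandoned routes x → z → w.
        ω : V → Carrier
        ω w = S L λ z → e z w

        0≤ω : NonNegative ω
        0≤ω w w∈L = S-nonNegative L λ z z∈L → 0≤e z z∈L w w∈L

        Sω≈s : S L ω ≈ s
        Sω≈s = ≈-trans (S-swap L L (λ w z → e z w)) (≈-trans (S-cong L Se≈a) Sa≈s)

        ex≈0 : ∀ w → w ∈ L → e x w ≈ 0#
        ex≈0 = S≈0⇒term≈0 (0≤e x x∈L) (≈-trans (Se≈a x x∈L) ax≈0)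

        ey≤p : ∀ u → u ∈ L → e u y ≤ p u y
        ey≤p u u∈L = ≤-respʳ-≈
          (≈-trans (+-congˡ (≈-trans (≈-trans (*-congʳ (δ-sym u y)) (≈-trans (δ*-cong y a u) (*-congˡ ay≈0))) (zeroʳ _)))
                   (+-identityʳ _))
          (e≤ u u∈L y y∈L)

        -- The inflow of `y` left over once `e` has claimed its part: `e` and the diverted mass are
        -- both going to be removed from column `y`.
        incoming : V → Carrier
        incoming u = p u y - e u y

        0≤incoming : NonNegative incoming
        0≤incoming u u∈L = a≤b⇒0≤b-a (ey≤p u u∈L)

        0≤s-ωy : 0# ≤ s - ω y
        0≤s-ωy = a≤b⇒0≤b-a (≤-respʳ-≈ Sω≈s (term≤S 0≤ω y∈L))

        -- Routes x → z → y that already end at `y` free their own room there, so only `s - ω y` has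
        -- to be diverted. Nothing of `p x y` may be used for it, and `t≤ny` ensures that the other
        -- inflow suffices.
        s-ωy≤ : s - ω y ≤ S L (erase x incoming)
        s-ωy≤ = begin
          (t - p x y) - ω y                              ≤⟨ ≤-slack (n y - t) (a≤b⇒0≤b-a t≤ny)
            (solve 4 (λ t p ω n → (n :- ω) :- (p :- :0) := ((t :- p) :- ω) :+ (n :- t)) ≈-refl t (p x y) (ω y) (n y)) ⟩
          (n y - ω y) - (p x y - 0#)
            ≈⟨ +-cong (+-congʳ (cols P y y∈L)) (-‿cong (+-congˡ (-‿cong (ex≈0 y y∈L)))) ⟨
          (S L (λ u → p u y) - ω y) - (p x y - e x y)    ≈⟨ +-congʳ (S-minus L _ _) ⟨
          S L incoming - incoming x                      ≈⟨ S-erase x∈L incoming ⟨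
          S L (erase x incoming)                         ∎
          where open ≤-Reasoning

        module Incoming (b : V → Carrier) (0≤b : NonNegative b)
          (b≤src : ∀ v → v ∈ L → b v ≤ erase x incoming v) (Sb≈ : S L b ≈ s - ω y) where

          b≤incoming : ∀ u → u ∈ L → b u ≤ incoming u
          b≤incoming u u∈L = ≤-trans (b≤src u u∈L) (erase≤ x 0≤incoming u u∈L)

          bx≈0 : b x ≈ 0#
          bx≈0 = squeeze (0≤b x x∈L) (b≤src x x∈L) (erase-self x incoming)

          ω′ : V → Carrier
          ω′ = erase y ω

          0≤ω′ : NonNegative ω′
          0≤ω′ = 0≤erase y 0≤ω

          -- `G` assigns to the sources that lose their target `y` the ends w ≠ y of the abandoned
          -- routes. How they are matched does not affect the estimate, since `step` bounds each
          -- diversion by the distance to `y` plus 1.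
          module Redirected (G : Plan b ω′) where
            private
              g = mass G

            0≤g : ∀ u v → u ∈ L → v ∈ L → 0# ≤ g u v
            0≤g = 0≤mass G

            -- If `n w` is zero, then `P` brings nothing to `w`; hence `a`, every `e z` and finally
            -- `g` vanish there.
            step : ∀ u w → u ∈ L → w ∈ L → D u w * g u w ≤ (D u y + 1#) * g u w
            step u w u∈L w∈L with zero⊎near w
            ... | inj₂ near = *-monoʳ-≤ (g u w) (0≤g u w u∈L w∈L) (near u)
            ... | inj₁ nw≈0 = ≤-reflexive (≈-trans (zero _) (≈-sym (zero _)))
              where
              pw≈0 : ∀ z → z ∈ L → p z w ≈ 0#
              pw≈0 = S≈0⇒term≈0 (0≤col w w∈L) (≈-trans (cols P w w∈L) nw≈0)

              aw≈0 : a w ≈ 0#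
              aw≈0 = squeeze (0≤a w w∈L) (a≤p w w∈L) (pw≈0 x x∈L)

              ew≈0 : ∀ z → z ∈ L → e z w ≈ 0#
              ew≈0 z z∈L = squeeze (0≤e z z∈L w w∈L) (e≤ z z∈L w w∈L) (≈-trans
                (+-cong (pw≈0 z z∈L) (≈-trans (≈-trans (*-congʳ (δ-sym z w)) (≈-trans (δ*-cong w a z) (*-congˡ aw≈0))) (zeroʳ _)))
                (+-identityˡ 0#))

              gw≈0 : g u w ≈ 0#
              gw≈0 = S≈0⇒term≈0 (λ v v∈L → 0≤g v w v∈L w∈L) (≈-trans (cols G w w∈L)
                (squeeze (0≤ω′ w w∈L) (erase≤ y 0≤ω w w∈L) (≈-trans (S-cong L ew≈0) (S-zero L)))) u u∈L

              zero : ∀ c → c * g u w ≈ 0#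
              zero c = ≈-trans (*-congˡ gw≈0) (zeroʳ c)

            -- R is removed from the plan and Q is added: x stops sending a, the
            -- flow e and the inflow b of y are diverted, and s goes from x to y.
            Q R : V → V → Carrier
            Q u w = δ u w * a u + (g u w + δ x u * (δ y w * s))
            R u w = e u w + (δ y w * b u + δ x u * a w)

            0≤δδs : ∀ u w → 0# ≤ δ x u * (δ y w * s)
            0≤δδs u w = *-nonNegative (0≤δ x u) (*-nonNegative (0≤δ y w) 0≤s)

            0≤g+δδs : ∀ u w → u ∈ L → w ∈ L → 0# ≤ g u w + δ x u * (δ y w * s)
            0≤g+δδs u w u∈L w∈L = +-nonNegative (0≤g u w u∈L w∈L) (0≤δδs u w)

            0≤Q : ∀ u w → u ∈ L → w ∈ L → 0# ≤ Q u w
            0≤Q u w u∈L w∈L = +-nonNegative (*-nonNegative (0≤δ u w) (0≤a u u∈L)) (0≤g+δδs u w u∈L w∈L)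

            Rx≈a : ∀ w → w ∈ L → R x w ≈ a w
            Rx≈a w w∈L = ≈-trans (+-cong (ex≈0 w w∈L) (+-cong (*-congˡ bx≈0) (*-congʳ (δ-refl x))))
              (solve 2 (λ d a → :0 :+ (d :* :0 :+ :1 :* a) := a) ≈-refl (δ y w) (a w))

            -- The three parts of `R` draw on separate supplies: `a` on row `x`, where `e` and `b`
            -- vanish; `b` on what `e` leaves in column `y`; and `e` elsewhere on `P`, supplemented
            -- on the diagonal by the mass that `Q` keeps in place.
            R≤p+Q : ∀ u w → u ∈ L → w ∈ L → R u w ≤ p u w + Q u w
            R≤p+Q u w u∈L w∈L = by-cases (lem {x ≡ u}) (lem {y ≡ w})
              where
              open ≤-Reasoning
              p≤p+Q : p u w ≤ p u w + Q u w
              p≤p+Q = ≤-slack (Q u w) (0≤Q u w u∈L w∈L) ≈-refl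

              drop-a : x ≢ u → R u w ≈ e u w + δ y w * b u
              drop-a x≢u = ≈-trans (+-congˡ (+-congˡ (*-congʳ (δ-≢ x≢u))))
                (solve 3 (λ c d a → c :+ (d :+ :0 :* a) := c :+ d) ≈-refl (e u w) (δ y w * b u) (a w))

              by-cases : Dec (x ≡ u) → Dec (y ≡ w) → R u w ≤ p u w + Q u w
              by-cases (yes ≡.refl) _ = begin
                R x w        ≈⟨ Rx≈a w w∈L ⟩
                a w          ≤⟨ a≤p w w∈L ⟩
                p x w        ≤⟨ p≤p+Q ⟩
                p x w + Q x w ∎
              by-cases (no x≢u) (yes ≡.refl) = begin
                R u y                        ≈⟨ drop-a x≢u ⟩
                e u y + δ y y * b u          ≈⟨ +-congˡ (≈-trans (*-congʳ (δ-refl y)) (*-identityˡ (b u))) ⟩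
                e u y + b u                  ≤⟨ +-monoʳ-≤ (e u y) (b≤incoming u u∈L) ⟩
                e u y + (p u y - e u y)      ≈⟨ solve 2 (λ e p → e :+ (p :- e) := p) ≈-refl (e u y) (p u y) ⟩
                p u y                        ≤⟨ p≤p+Q ⟩
                p u y + Q u y                ∎
              by-cases (no x≢u) (no y≢w) = begin
                R u w                        ≈⟨ drop-a x≢u ⟩
                e u w + δ y w * b u          ≈⟨ +-congˡ (≈-trans (*-congʳ (δ-≢ y≢w)) (zeroˡ (b u))) ⟩
                e u w + 0#                   ≈⟨ +-identityʳ (e u w) ⟩
                e u w                        ≤⟨ e≤ u u∈L w w∈L ⟩
                p u w + δ u w * a u          ≤⟨ +-monoʳ-≤ (p u w) (≤-slack _ (0≤g+δδs u w u∈L w∈L) ≈-refl) ⟩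
                p u w + Q u w                ∎

            Q-rows : ∀ u → u ∈ L → S L (Q u) ≈ a u + (b u + δ x u * s)
            Q-rows u u∈L = ≈-trans (S-+ L _ _) (+-cong (S-δ* L-unique u∈L (λ _ → a u)) (≈-trans (S-+ L _ _)
              (+-cong (rows G u u∈L) (≈-trans (S-*ˡ L (δ x u) _) (*-congˡ (S-δ* L-unique y∈L (λ _ → s)))))))

            R-rows : ∀ u → u ∈ L → S L (R u) ≈ a u + (b u + δ x u * s)
            R-rows u u∈L = ≈-trans (S-+ L _ _) (+-cong (Se≈a u u∈L) (≈-trans (S-+ L _ _)
              (+-cong (S-δ* L-unique y∈L (λ _ → b u)) (≈-trans (S-*ˡ L (δ x u) a) (*-congˡ Sa≈s)))))

            Q-cols : ∀ w → w ∈ L → S L (λ u → Q u w) ≈ a w + (ω′ w + δ y w * s)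
            Q-cols w w∈L = ≈-trans (S-+ L _ _) (+-cong
              (≈-trans (S-cong L λ u _ → *-congʳ (δ-sym u w)) (S-δ* L-unique w∈L a)) (≈-trans (S-+ L _ _)
              (+-cong (cols G w w∈L) (S-δ* L-unique x∈L (λ _ → δ y w * s)))))

            R-cols : ∀ w → w ∈ L → S L (λ u → R u w) ≈ ω w + (δ y w * (s - ω y) + a w)
            R-cols w w∈L = ≈-trans (S-+ L _ _) (+-congˡ (≈-trans (S-+ L _ _)
              (+-cong (≈-trans (S-*ˡ L (δ y w) b) (*-congˡ Sb≈)) (S-δ* L-unique x∈L (λ _ → a w)))))

            cols≈ : ∀ w → w ∈ L → S L (λ u → Q u w) ≈ S L (λ u → R u w)
            cols≈ w w∈L = begin-equality
              S L (λ u → Q u w)                                   ≈⟨ Q-cols w w∈L ⟩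
              a w + ((1# - δ y w) * ω w + δ y w * s)              ≈⟨ solve 4 (λ a d w s →
                a :+ ((:1 :- d) :* w :+ d :* s) := a :+ ((w :- d :* w) :+ d :* s))
                     ≈-refl (a w) (δ y w) (ω w) s ⟩
              -- Under the factor `δ y w` the values `ω w` and `ω y` agree; the part of `ω` erased
              -- at `y` is exactly what `b` was spared.
              a w + ((ω w - δ y w * ω w) + δ y w * s)
                ≈⟨ +-congˡ (+-congʳ (+-congˡ (-‿cong (δ*-cong y ω w)))) ⟩
              a w + ((ω w - δ y w * ω y) + δ y w * s)             ≈⟨ solve 5 (λ a d w v s →
                a :+ ((w :- d :* v) :+ d :* s) := w :+ (d :* (s :- v) :+ a))
                     ≈-refl (a w) (δ y w) (ω w) (ω y) s ⟩
              ω w + (δ y w * (s - ω y) + a w)                     ≈⟨ R-cols w w∈L ⟨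
              S L (λ u → R u w)                                   ∎
              where open ≤-Reasoning

            P′ : Plan m n
            P′ = exchange P Q R R≤p+Q (λ u u∈L → ≈-trans (Q-rows u u∈L) (≈-sym (R-rows u u∈L))) cols≈

            -- `R` takes nothing from this entry, since `a y` is zero, while `Q` adds the whole
            -- deficit `s`.
            t≤P′xy : t ≤ mass P′ x y
            t≤P′xy = ≤-slack (δ x y * a x + g x y)
              (+-nonNegative (*-nonNegative (0≤δ x y) (0≤a x x∈L)) (0≤g x y x∈L y∈L))
              (begin-equality
                (p x y + Q x y) - R x y
                  ≈⟨ +-cong (+-congˡ (+-congˡ (+-congˡ (*-cong (δ-refl x) (*-congʳ (δ-refl y))))))
                                                   (-‿cong (≈-trans (Rx≈a y y∈L) ay≈0)) ⟩
                (p x y + (δ x y * a x + (g x y + 1# * (1# * (t - p x y))))) - 0#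
                  ≈⟨ solve 4 (λ p c g t → (p :+ (c :+ (g :+ :1 :* (:1 :* (t :- p))))) :- :0 := t :+ (c :+ g)) ≈-refl
                       (p x y) (δ x y * a x) (g x y) t ⟩
                t + (δ x y * a x + g x y)     ∎)
              where open ≤-Reasoning

            X Y Z : Carrier
            X = S L λ u → D u y * b u
            Y = SS λ u w → D u w * e u w
            Z = S L λ w → D x w * a w

            -- Mass that stays put is free. One `s` bounds the extra step of the diverted mass,
            -- whose total is only `s - ω y`; the other pays for the unit transports from `x` to
            -- `y`.
            cost-Q≤ : cost D Q ≤ (X + s) + s
            cost-Q≤ = begin
              cost D Q
                ≤⟨ SS-mono pointwise ⟩
              SS (λ u w → (D u y * g u w + g u w) + δ x u * (δ y w * (D u w * s)))
                ≈⟨ ≈-trans (SS-+ _ _) (+-congʳ (SS-+ _ _)) ⟩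
              (SS (λ u w → D u y * g u w) + SS g) + SS (λ u w → δ x u * (δ y w * (D u w * s)))
                ≈⟨ +-cong (+-cong
                     (S-cong L λ u u∈L → ≈-trans (S-*ˡ L (D u y) (g u)) (*-congˡ (rows G u u∈L)))
                     (≈-trans (S-cong L (rows G)) Sb≈))
                     (≈-trans (SS-unit x∈L y∈L (λ u w → D u w * s)) (≈-trans (*-congʳ Dxy≈1) (*-identityˡ s))) ⟩
              (X + (s - ω y)) + s
                ≤⟨ ≤-slack (ω y) (0≤ω y y∈L) (solve 3 (λ X s w → (X :+ s) :+ s := ((X :+ (s :- w)) :+ s) :+ w) ≈-refl X s (ω y)) ⟩
              (X + s) + s ∎
              where
              open ≤-Reasoning
              vanish : ∀ u w → D u w * (δ u w * a u) ≈ 0#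
              vanish u w = ≈-trans (solve 3 (λ D d a → D :* (d :* a) := (d :* D) :* a)
                   ≈-refl (D u w) (δ u w) (a u))
                (≈-trans (*-congʳ (≈-trans (δ*-cong u (D u) w) (≈-trans (*-congˡ (D-diagonal u)) (zeroʳ _)))) (zeroˡ _))

              pointwise : ∀ u w → u ∈ L → w ∈ L →
                D u w * Q u w ≤ (D u y * g u w + g u w) + δ x u * (δ y w * (D u w * s))
              pointwise u w u∈L w∈L = begin
                D u w * Q u w
                  ≈⟨ solve 6 (λ D c g d f s → D :* (c :+ (g :+ d :* (f :* s))) := (D :* c :+ D :* g) :+ d :* (f :* (D :* s)))
                       ≈-refl (D u w) (δ u w * a u) (g u w) (δ x u) (δ y w) s ⟩
                (D u w * (δ u w * a u) + D u w * g u w) + δ x u * (δ y w * (D u w * s))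
                  ≤⟨ +-mono-≤ (+-mono-≤ (≤-reflexive (vanish u w)) (step u w u∈L w∈L)) ≤-refl ⟩
                (0# + (D u y + 1#) * g u w) + δ x u * (δ y w * (D u w * s))
                  ≈⟨ +-congʳ (solve 2 (λ D g → :0 :+ (D :+ :1) :* g := D :* g :+ g) ≈-refl (D u y) (g u w)) ⟩
                (D u y * g u w + g u w) + δ x u * (δ y w * (D u w * s)) ∎

            -- The abandoned routes x → z → w cost `Z + Y`, which is at least 2 per unit by `long`,
            -- hence at least 2s in total. This matches the two copies of `s` in `cost-Q≤`, while
            -- `X` appears on both sides.
            cost-R≥ : (X + s) + s ≤ cost D R
            cost-R≥ = begin
              (X + s) + s
                ≈⟨ solve 2 (λ X s → (X :+ s) :+ s := X :+ (:1 :+ :1) :* s) ≈-refl X s ⟩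
              X + (1# + 1#) * s
                ≈⟨ +-congˡ (*-congˡ (≈-trans (S-cong L Se≈a) Sa≈s)) ⟨
              X + (1# + 1#) * SS e
                ≈⟨ +-congˡ (SS-*ˡ _ e) ⟨
              X + SS (λ z w → (1# + 1#) * e z w)
                ≤⟨ +-monoʳ-≤ X (SS-mono λ z w z∈L → long z z∈L w) ⟩
              X + SS (λ z w → (D x z + D z w) * e z w)
                ≈⟨ +-congˡ (≈-trans (SS-cong λ z w _ _ → distribʳ (e z w) (D x z) (D z w)) (SS-+ _ _)) ⟩
              X + (SS (λ z w → D x z * e z w) + Y)
                ≈⟨ +-congˡ (+-congʳ (S-cong L λ z z∈L → ≈-trans (S-*ˡ L (D x z) (e z)) (*-congˡ (Se≈a z z∈L)))) ⟩
              X + (Z + Y)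
                ≈⟨ solve 3 (λ X Z Y → X :+ (Z :+ Y) := Y :+ (X :+ Z)) ≈-refl X Z Y ⟩
              Y + (X + Z)
                ≈⟨ +-congˡ (+-cong (S-cong L λ u _ → S-δ* L-unique y∈L (λ w → D u w * b u))
                     (≈-trans (S-cong L λ u _ → S-*ˡ L (δ x u) _) (S-δ* L-unique x∈L (λ u → S L λ w → D u w * a w)))) ⟨
              Y + (SS (λ u w → δ y w * (D u w * b u)) + SS (λ u w → δ x u * (D u w * a w)))
                ≈⟨ ≈-trans (SS-+ _ _) (+-congˡ (SS-+ _ _)) ⟨
              SS (λ u w → D u w * e u w + (δ y w * (D u w * b u) + δ x u * (D u w * a w)))
                ≈⟨ SS-cong (λ u w _ _ → solve 6 (λ D e d b c a → D :* e :+ (d :* (D :* b) :+ c :* (D :* a))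
                     := D :* (e :+ (d :* b :+ c :* a))) ≈-refl (D u w) (e u w) (δ y w) (b u) (δ x u) (a w)) ⟩
              cost D R ∎
              where open ≤-Reasoning

            result : ∃ λ (P′ : Plan m n) → t ≤ mass P′ x y × cost D (mass P′) ≤ cost D p
            result = P′ , t≤P′xy , cost-exchange D p Q R (≤-trans cost-Q≤ cost-R≥)

    rerouted : ∃ λ (P′ : Plan m n) → t ≤ mass P′ x y × cost D (mass P′) ≤ cost D p
    rerouted =
      let a , 0≤a , a≤src , Sa≈s = rerouted-share
          module Sh = Share a 0≤a a≤src Sa≈s
          e , e-spec = choose (λ _ → 0#) Sh.continuation
          module Co = Sh.Continued e e-spec
          b , 0≤b , b≤src , Sb≈ = select (0≤erase x Co.0≤incoming) Co.0≤s-ωy Co.s-ωy≤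
          module In = Co.Incoming b 0≤b b≤src Sb≈
      in In.Redirected.result (couple 0≤b In.0≤ω′ (≈-trans Sb≈ (≈-sym (≈-trans (S-erase y∈L Co.ω) (+-congʳ Co.Sω≈s)))))

  reroute : (D : V → V → Carrier) → (∀ v → D v v ≈ 0#) → (∀ {u v} → u ≢ v → 1# ≤ D u v) →
    ∀ {x y} → x ∈ L → y ∈ L → x ≢ y → D x y ≈ 1# → ∀ {m n} →
    (∀ z → z ≢ x → z ≢ y → 1# + 1# ≤ D x z ⊎ n z ≤ m z) →
    (∀ w → n w ≈ 0# ⊎ (∀ u → D u w ≤ D u y + 1#)) →
    ∀ t → t ≤ n y → t ≤ m x - n x → (P : Plan m n) →
    ∃ λ (P′ : Plan m n) → t ≤ mass P′ x y × cost D (mass P′) ≤ cost D (mass P)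
  reroute D D-diagonal 1≤D {x} {y} x∈L y∈L x≢y Dxy≈1 far⊎heavy zero⊎near t t≤ny t≤mx-nx P with total t (mass P x y)
  ... | inj₁ t≤Pxy = P , t≤Pxy , ≤-refl
  ... | inj₂ Pxy≤t =
        Reroute.rerouted D D-diagonal 1≤D x∈L y∈L x≢y Dxy≈1 far⊎heavy zero⊎near t t≤ny t≤mx-nx P Pxy≤t

-- Lazy measures

module LazyTransport (lem : ExcludedMiddle 0ℓ) (ℛ : CompleteOrderedField)
                 {V : Set} (L : List V) (L-unique : Unique L) where
  open OrderedField ℛ
  open FiniteSums lem ℛ
  open Transport lem ℛ L L-unique
  open Rerouting lem ℛ L L-unique using (reroute)
  open Solver using (solve; _:+_; _:*_; _:-_; _:=_; :0; :1)

  -- The walk measure with its idleness separated from the walk without idleness `ν`, so that the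
  -- dependence on `α` is affine on all of V.
  lazy : Carrier → V → (V → Carrier) → V → Carrier
  lazy α x ν v = α * δ x v + (1# - α) * ν v

  lazy-self : ∀ α x ν → ν x ≈ 0# → lazy α x ν x ≈ α
  lazy-self α x ν νx≈0 = ≈-trans (+-cong (*-congˡ (δ-refl x)) (*-congˡ νx≈0))
    (solve 1 (λ α → α :* :1 :+ (:1 :- α) :* :0 := α) ≈-refl α)

  lazy-other : ∀ α {x v} ν → x ≢ v → lazy α x ν v ≈ (1# - α) * ν v
  lazy-other α {x} {v} ν x≢v = ≈-trans (+-congʳ (*-congˡ (δ-≢ x≢v)))
    (solve 2 (λ α c → α :* :0 :+ c := c) ≈-refl α ((1# - α) * ν v))

  0≤lazy : ∀ {α x ν} → 0# ≤ α → α ≤ 1# → NonNegative ν → NonNegative (lazy α x ν)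
  0≤lazy {x = x} 0≤α α≤1 0≤ν v v∈L = +-nonNegative (*-nonNegative 0≤α (0≤δ x v))
    (*-nonNegative (a≤b⇒0≤b-a α≤1) (0≤ν v v∈L))

  S-lazy : ∀ {α x ν} → x ∈ L → S L ν ≈ 1# → S L (lazy α x ν) ≈ 1#
  S-lazy {α} {x} {ν} x∈L Sν≈1 = begin-equality
    S L (lazy α x ν)                   ≈⟨ S-+ L _ _ ⟩
    S L (λ v → α * δ x v) + S L (λ v → (1# - α) * ν v)
      ≈⟨ +-cong (≈-trans (S-*ˡ L α (δ x)) (*-congˡ (S-δ L-unique x∈L)))
                (≈-trans (S-*ˡ L (1# - α) ν) (*-congˡ Sν≈1)) ⟩
    α * 1# + (1# - α) * 1#             ≈⟨ solve 1 (λ α → α :* :1 :+ (:1 :- α) :* :1 := :1) ≈-refl α ⟩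
    1#                                 ∎
    where open ≤-Reasoning

  -- Both sides are the point mass at `x` moved towards `ν` by the same fraction, 1 - β = θ (1 - α).
  lazy-mix : ∀ {α β θ} x ν v → θ * (1# - α) ≈ 1# - β →
             lazy β x ν v ≈ θ * lazy α x ν v + (1# - θ) * δ x v
  lazy-mix {α} {β} {θ} x ν v eq = begin-equality
    β * δ x v + (1# - β) * ν v
      ≈⟨ solve 3 (λ β d n → β :* d :+ (:1 :- β) :* n := d :- (:1 :- β) :* (d :- n)) ≈-refl β (δ x v) (ν v) ⟩
    δ x v - (1# - β) * (δ x v - ν v)
      ≈⟨ +-congˡ (-‿cong (*-congʳ (≈-sym eq))) ⟩
    δ x v - θ * (1# - α) * (δ x v - ν v)
      ≈⟨ solve 4 (λ α θ d n → d :- θ :* (:1 :- α) :* (d :- n) := θ :* (α :* d :+ (:1 :- α) :* n) :+ (:1 :- θ) :* d)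
           ≈-refl α θ (δ x v) (ν v) ⟩
    θ * lazy α x ν v + (1# - θ) * δ x v ∎
    where open ≤-Reasoning

  swapPlan : ∀ {m n} → Plan m n → Plan n m
  swapPlan P = record
    { mass   = λ u v → mass P v u
    ; 0≤mass = λ u v u∈L v∈L → 0≤mass P v u v∈L u∈L
    ; rows   = cols P
    ; cols   = rows P
    }

  -- An infimum described by real lower bounds, so that plans can be compared singly and no
  -- minimiser has to be produced.
  IsCostInfimum : (D : V → V → Carrier) (m n : V → Carrier) → Carrier → Set
  IsCostInfimum D m n w =
    (∀ (P : Plan m n) → w ≤ cost D (mass P)) ×
    (∀ c → (∀ (P : Plan m n) → c ≤ cost D (mass P)) → c ≤ w)

  -- The interface between the two regimes and the affine law: it holds with the plan itself when
  -- the idleness is at least 1/2, and through the exchange in the linear uniform case.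
  Reroutable : (D : V → V → Carrier) (m n : V → Carrier) (x y : V) → Carrier → Set
  Reroutable D m n x y t = (P : Plan m n) →
    ∃ λ (P′ : Plan m n) → t ≤ mass P′ x y × cost D (mass P′) ≤ cost D (mass P)

  module _ {α β θ : Carrier} (0<θ : 0# < θ) (θ≤1 : θ ≤ 1#) (θ[1-α]≈1-β : θ * (1# - α) ≈ 1# - β)
           {x y : V} (x∈L : x ∈ L) (y∈L : y ∈ L) {ν₁ ν₂ : V → Carrier} where

    mix : Plan (lazy α x ν₁) (lazy α y ν₂) → Plan (lazy β x ν₁) (lazy β y ν₂)
    mix P = record
      { mass   = λ u v → θ * mass P u v + (1# - θ) * (δ x u * δ y v)
      ; 0≤mass = λ u v u∈L v∈L → +-nonNegative (*-nonNegative (proj₁ 0<θ) (0≤mass P u v u∈L v∈L))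
          (*-nonNegative (a≤b⇒0≤b-a θ≤1) (*-nonNegative (0≤δ x u) (0≤δ y v)))
      ; rows   = λ u u∈L → ≈-trans (S-+ L _ _) (≈-trans (+-cong
          (≈-trans (S-*ˡ L θ _) (*-congˡ (rows P u u∈L)))
          (≈-trans (S-*ˡ L (1# - θ) _) (*-congˡ (≈-trans (S-*ˡ L (δ x u) (δ y))
            (≈-trans (*-congˡ (S-δ L-unique y∈L)) (*-identityʳ _))))))
          (≈-sym (lazy-mix x ν₁ u θ[1-α]≈1-β)))
      ; cols   = λ v v∈L → ≈-trans (S-+ L _ _) (≈-trans (+-cong
          (≈-trans (S-*ˡ L θ _) (*-congˡ (cols P v v∈L)))
          (≈-trans (S-*ˡ L (1# - θ) _) (*-congˡ (S-δ* L-unique x∈L (λ _ → δ y v)))))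
          (≈-sym (lazy-mix y ν₂ v θ[1-α]≈1-β)))
      }

    cost-mix : ∀ D q → cost D (λ u v → θ * q u v + (1# - θ) * (δ x u * δ y v)) ≈ θ * cost D q + (1# - θ) * D x y
    cost-mix D q = begin-equality
      cost D (λ u v → θ * q u v + (1# - θ) * (δ x u * δ y v))
        ≈⟨ SS-cong (λ u v _ _ → solve 5 (λ D θ q a b → D :* (θ :* q :+ (:1 :- θ) :* (a :* b))
             := θ :* (D :* q) :+ (:1 :- θ) :* (a :* (b :* D))) ≈-refl (D u v) θ (q u v) (δ x u) (δ y v)) ⟩
      SS (λ u v → θ * (D u v * q u v) + (1# - θ) * (δ x u * (δ y v * D u v)))
        ≈⟨ ≈-trans (SS-+ _ _) (+-cong (SS-*ˡ θ _) (SS-*ˡ (1# - θ) _)) ⟩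
      θ * cost D q + (1# - θ) * SS (λ u v → δ x u * (δ y v * D u v))
        ≈⟨ +-congˡ (*-congˡ (SS-unit x∈L y∈L D)) ⟩
      θ * cost D q + (1# - θ) * D x y ∎
      where open ≤-Reasoning

    private
      θ≉0 : ¬ θ ≈ 0#
      θ≉0 = 0<x⇒x≉0 0<θ

    -- Subtracting the multiple of the unit transport changes only the entry at `(x , y)`, so that
    -- entry alone has to be large enough. The marginals follow by cancelling the point masses and θ
    -- in `lazy-mix`.
    unmix : (P : Plan (lazy β x ν₁) (lazy β y ν₂)) → 1# - θ ≤ mass P x y →
            ∃ λ (P′ : Plan (lazy α x ν₁) (lazy α y ν₂)) →
              ∀ u v → mass P u v ≈ θ * mass P′ u v + (1# - θ) * (δ x u * δ y v)
    unmix P 1-θ≤Pxy = record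
      { mass   = q
      ; 0≤mass = λ u v u∈L v∈L → *-nonNegative (0≤x⁻¹ 0<θ) (a≤b⇒0≤b-a (bound u v u∈L v∈L))
      ; rows   = λ u u∈L → cancel (begin-equality
          θ * S L (q u) + (1# - θ) * δ x u         ≈⟨ +-cong (≈-sym (S-*ˡ L θ (q u)))
            (≈-sym (≈-trans (S-*ˡ L (1# - θ) _) (*-congˡ (≈-trans (S-*ˡ L (δ x u) (δ y))
              (≈-trans (*-congˡ (S-δ L-unique y∈L)) (*-identityʳ _)))))) ⟩
          S L (λ v → θ * q u v) + S L (λ v → (1# - θ) * (δ x u * δ y v))   ≈⟨ S-+ L _ _ ⟨
          S L (λ v → θ * q u v + (1# - θ) * (δ x u * δ y v))   ≈⟨ S-cong L (λ v _ → decomposition u v) ⟨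
          S L (mass P u)                           ≈⟨ rows P u u∈L ⟩
          lazy β x ν₁ u                            ≈⟨ lazy-mix x ν₁ u θ[1-α]≈1-β ⟩
          θ * lazy α x ν₁ u + (1# - θ) * δ x u     ∎)
      ; cols   = λ v v∈L → cancel (begin-equality
          θ * S L (λ u → q u v) + (1# - θ) * δ y v    ≈⟨ +-cong (≈-sym (S-*ˡ L θ _))
            (≈-sym (≈-trans (S-*ˡ L (1# - θ) _) (*-congˡ (S-δ* L-unique x∈L (λ _ → δ y v))))) ⟩
          S L (λ u → θ * q u v) + S L (λ u → (1# - θ) * (δ x u * δ y v))   ≈⟨ S-+ L _ _ ⟨
          S L (λ u → θ * q u v + (1# - θ) * (δ x u * δ y v))   ≈⟨ S-cong L (λ u _ → decomposition u v) ⟨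
          S L (λ u → mass P u v)                      ≈⟨ cols P v v∈L ⟩
          lazy β y ν₂ v                               ≈⟨ lazy-mix y ν₂ v θ[1-α]≈1-β ⟩
          θ * lazy α y ν₂ v + (1# - θ) * δ y v        ∎)
      } , decomposition
      where
      open ≤-Reasoning
      q : V → V → Carrier
      q u v = θ ⁻¹ * (mass P u v - (1# - θ) * (δ x u * δ y v))

      decomposition : ∀ u v → mass P u v ≈ θ * q u v + (1# - θ) * (δ x u * δ y v)
      decomposition u v = ≈-sym (begin-equality
        θ * (θ ⁻¹ * (mass P u v - c)) + c     ≈⟨ +-congʳ (*-assoc _ _ _) ⟨
        (θ * θ ⁻¹) * (mass P u v - c) + c     ≈⟨ +-congʳ (*-congʳ (*-inverseʳ θ θ≉0)) ⟩
        1# * (mass P u v - c) + c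
          ≈⟨ solve 2 (λ p c → :1 :* (p :- c) :+ c := p) ≈-refl (mass P u v) c ⟩
        mass P u v                            ∎)
        where
        c = (1# - θ) * (δ x u * δ y v)

      bound : ∀ u v → u ∈ L → v ∈ L → (1# - θ) * (δ x u * δ y v) ≤ mass P u v
      bound u v u∈L v∈L with lem {x ≡ u} | lem {y ≡ v}
      ... | yes ≡.refl | yes ≡.refl = ≤-respˡ-≈ (solve 1 (λ c → c := c :* (:1 :* :1)) ≈-refl (1# - θ)) 1-θ≤Pxy
      ... | yes _      | no _       = ≤-respˡ-≈ (solve 1 (λ c → :0 := c :* (:1 :* :0))
           ≈-refl (1# - θ)) (0≤mass P u v u∈L v∈L)
      ... | no _       | yes _      = ≤-respˡ-≈ (solve 1 (λ c → :0 := c :* (:0 :* :1))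
           ≈-refl (1# - θ)) (0≤mass P u v u∈L v∈L)
      ... | no _       | no _       = ≤-respˡ-≈ (solve 1 (λ c → :0 := c :* (:0 :* :0))
           ≈-refl (1# - θ)) (0≤mass P u v u∈L v∈L)

      cancel : ∀ {a b c} → θ * a + c ≈ θ * b + c → a ≈ b
      cancel {a} {b} {c} eq =
          antisym (*-cancelˡ-≤ θ 0<θ (≤-reflexive θa≈θb)) (*-cancelˡ-≤ θ 0<θ (≤-reflexive (≈-sym θa≈θb)))
        where
        θa≈θb : θ * a ≈ θ * b
        θa≈θb = begin-equality
          θ * a              ≈⟨ solve 2 (λ a c → a := (a :+ c) :- c) ≈-refl (θ * a) c ⟩
          (θ * a + c) - c    ≈⟨ +-congʳ eq ⟩
          (θ * b + c) - c    ≈⟨ solve 2 (λ a c → (a :+ c) :- c := a) ≈-refl (θ * b) c ⟩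
          θ * b              ∎

    -- Formulated for 1 - w, the curvature at distance 1: as θ = (1 - β) / (1 - α), the conclusion
    -- says that curvature divided by one minus idleness is the same at α and at β.
    infimum-affine : ∀ {D} → D x y ≈ 1# →
      Reroutable D (lazy β x ν₁) (lazy β y ν₂) x y (1# - θ) →
      ∀ {wα wβ} → IsCostInfimum D (lazy α x ν₁) (lazy α y ν₂) wα →
                  IsCostInfimum D (lazy β x ν₁) (lazy β y ν₂) wβ →
      1# - wβ ≈ θ * (1# - wα)
    infimum-affine {D} Dxy≈1 reroutable {wα} {wβ} (α-lower , α-greatest) (β-lower , β-greatest) =
      ≈-trans (+-congˡ (-‿cong (antisym wβ≤ ≤wβ)))
        (solve 2 (λ θ w → :1 :- (θ :* w :+ (:1 :- θ)) := θ :* (:1 :- w)) ≈-refl θ wα)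
      where
      open ≤-Reasoning
      cost-mix₁ : ∀ q → cost D (λ u v → θ * q u v + (1# - θ) * (δ x u * δ y v)) ≈ θ * cost D q + (1# - θ)
      cost-mix₁ q = ≈-trans (cost-mix D q) (+-congˡ (≈-trans (*-congˡ Dxy≈1) (*-identityʳ _)))

      -- The bound on a cost at α obtained by solving `wβ` ≤ θ · cost + (1 - θ) for the cost.
      c = θ ⁻¹ * (wβ - (1# - θ))

      θc≈ : θ * c ≈ wβ - (1# - θ)
      θc≈ = ≈-trans (≈-sym (*-assoc _ _ _)) (≈-trans (*-congʳ (*-inverseʳ θ θ≉0)) (*-identityˡ _))

      c≤cost : ∀ P → c ≤ cost D (mass P)
      c≤cost P = *-cancelˡ-≤ θ 0<θ (begin
        θ * c                                            ≈⟨ θc≈ ⟩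
        wβ - (1# - θ)                                    ≤⟨ +-mono-≤ (β-lower (mix P)) ≤-refl ⟩
        cost D (mass (mix P)) - (1# - θ)                 ≈⟨ +-congʳ (cost-mix₁ (mass P)) ⟩
        (θ * cost D (mass P) + (1# - θ)) - (1# - θ)
          ≈⟨ solve 2 (λ a c → (a :+ c) :- c := a) ≈-refl (θ * cost D (mass P)) (1# - θ) ⟩
        θ * cost D (mass P)                              ∎)

      wβ≤ : wβ ≤ θ * wα + (1# - θ)
      wβ≤ = begin
        wβ                             ≈⟨ solve 2 (λ w c → w := (w :- c) :+ c) ≈-refl wβ (1# - θ) ⟩
        (wβ - (1# - θ)) + (1# - θ)     ≈⟨ +-congʳ θc≈ ⟨
        θ * c + (1# - θ)               ≤⟨ +-mono-≤ (*-monoˡ-≤ θ (proj₁ 0<θ) (α-greatest c c≤cost)) ≤-refl ⟩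
        θ * wα + (1# - θ)              ∎

      ≤wβ : θ * wα + (1# - θ) ≤ wβ
      ≤wβ = β-greatest _ λ P →
        let P′ , 1-θ≤P′xy , cost≤ = reroutable P
            P″ , decomposition    = unmix P′ 1-θ≤P′xy
        in begin
        θ * wα + (1# - θ)                        ≤⟨ +-mono-≤ (*-monoˡ-≤ θ (proj₁ 0<θ) (α-lower P″)) ≤-refl ⟩
        θ * cost D (mass P″) + (1# - θ)          ≈⟨ cost-mix₁ (mass P″) ⟨
        cost D (λ u v → θ * mass P″ u v + (1# - θ) * (δ x u * δ y v))
          ≈⟨ SS-cong (λ u v _ _ → *-congˡ (≈-sym (decomposition u v))) ⟩
        cost D (mass P′)                         ≤⟨ cost≤ ⟩
        cost D (mass P)                          ∎

    module _ (x≢y : x ≢ y) (0≤ν₁ : NonNegative ν₁) (0≤ν₂ : NonNegative ν₂)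
             (ν₁x≈0 : ν₁ x ≈ 0#) (ν₂y≈0 : ν₂ y ≈ 0#) (0≤α : 0# ≤ α) (β≤1 : β ≤ 1#) where
      open ≤-Reasoning

      0≤1-β : 0# ≤ 1# - β
      0≤1-β = a≤b⇒0≤b-a β≤1

      -- `x` can send at most 1 - β to vertices other than `y`, hence sends at least 2β - 1 to `y`.
      -- Moreover 2 (1 - β) = 2θ (1 - α) ≤ θ exactly because 2α ≥ 1, so 2β - 1 ≥ 1 - θ.
      reroutable-half : ∀ {D} → S L ν₂ ≈ 1# → 1# ≤ α + α →
        Reroutable D (lazy β x ν₁) (lazy β y ν₂) x y (1# - θ)
      reroutable-half Sν₂≈1 1≤2α P = P , bound , ≤-refl
        where
        n = lazy β y ν₂
        p = mass P

        p≤n : ∀ v → v ∈ L → erase y (p x) v ≤ erase y n v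
        p≤n v v∈L =
            *-monoˡ-≤ (1# - δ y v) (a≤b⇒0≤b-a (≤-trans (term≤S (λ b _ → 0≤δ y b) v∈L) (S-δ≤1 L-unique y)))
          (≤-respʳ-≈ (cols P v v∈L) (term≤S (λ u u∈L → 0≤mass P u v u∈L v∈L) x∈L))

        β-pxy≤1-β : β - p x y ≤ 1# - β
        β-pxy≤1-β = begin
          β - p x y                   ≈⟨ +-congʳ (≈-trans (rows P x x∈L) (lazy-self β x ν₁ ν₁x≈0)) ⟨
          S L (p x) - p x y           ≈⟨ S-erase y∈L (p x) ⟨
          S L (erase y (p x))         ≤⟨ S-mono L p≤n ⟩
          S L (erase y n)             ≈⟨ S-erase y∈L n ⟩
          S L n - n y                 ≈⟨ +-cong (S-lazy y∈L Sν₂≈1) (-‿cong (lazy-self β y ν₂ ν₂y≈0)) ⟩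
          1# - β                      ∎

        θ-slack : 0# ≤ θ * ((α + α) - 1#)
        θ-slack = *-nonNegative (proj₁ 0<θ) (a≤b⇒0≤b-a 1≤2α)

        bound : 1# - θ ≤ p x y
        bound =
            ≤-slack (((1# - β) - (β - p x y)) + θ * ((α + α) - 1#)) (+-nonNegative (a≤b⇒0≤b-a β-pxy≤1-β) θ-slack)
          (begin-equality
            p x y
              ≈⟨ solve 2 (λ β p → p := (:1 :- ((:1 :- β) :+ (:1 :- β))) :+ ((:1 :- β) :- (β :- p))) ≈-refl β (p x y) ⟩
            (1# - ((1# - β) + (1# - β))) + ((1# - β) - (β - p x y))
              ≈⟨ +-congʳ (+-congˡ (-‿cong (+-cong θ[1-α]≈1-β θ[1-α]≈1-β))) ⟨
            (1# - (θ * (1# - α) + θ * (1# - α))) + ((1# - β) - (β - p x y))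
              ≈⟨ solve 3 (λ θ α c → (:1 :- (θ :* (:1 :- α) :+ θ :* (:1 :- α))) :+ c := (:1 :- θ) :+ (c :+ θ :* ((α :+ α) :- :1)))
                   ≈-refl θ α ((1# - β) - (β - p x y)) ⟩
            (1# - θ) + (((1# - β) - (β - p x y)) + θ * ((α + α) - 1#)) ∎)

      -- For the amount 1 - θ, the requirement that it be at most `m x - n x` becomes (1 - β)(1 + ν₂
      -- x) ≤ θ; dividing by θ gives `lazy-enough`. The other hypotheses carry over from `ν₁` and
      -- `ν₂`, since away from `x` and `y` laziness only scales both by 1 - β.
      reroutable-heavy : ∀ {D} → (∀ v → D v v ≈ 0#) → (∀ {u v} → u ≢ v → 1# ≤ D u v) → D x y ≈ 1# →
        (∀ z → z ≢ x → z ≢ y → 1# + 1# ≤ D x z ⊎ ν₂ z ≤ ν₁ z) →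
        (∀ w → w ≢ y → ν₂ w ≈ 0# ⊎ (∀ u → D u w ≤ D u y + 1#)) →
        (1# - α) * (1# + ν₂ x) ≤ 1# →
        Reroutable D (lazy β x ν₁) (lazy β y ν₂) x y (1# - θ)
      reroutable-heavy {D} D-diagonal 1≤D Dxy≈1 far⊎heavy zero⊎near lazy-enough =
        reroute D D-diagonal 1≤D x∈L y∈L x≢y Dxy≈1 far⊎heavy′ zero⊎near′ (1# - θ)
          (≤-respʳ-≈ (≈-sym (lazy-self β y ν₂ ν₂y≈0)) 1-θ≤β)
          (≤-respʳ-≈ (≈-sym (+-cong (lazy-self β x ν₁ ν₁x≈0) (-‿cong (lazy-other β ν₂ λ y≡x → x≢y (≡.sym y≡x))))) 1-θ≤)
        where
        far⊎heavy′ : ∀ z → z ≢ x → z ≢ y → 1# + 1# ≤ D x z ⊎ lazy β y ν₂ z ≤ lazy β x ν₁ z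
        far⊎heavy′ z z≢x z≢y with far⊎heavy z z≢x z≢y
        ... | inj₁ far   = inj₁ far
        ... | inj₂ ν₂≤ν₁ = inj₂ (begin
          lazy β y ν₂ z       ≈⟨ lazy-other β ν₂ (λ y≡z → z≢y (≡.sym y≡z)) ⟩
          (1# - β) * ν₂ z     ≤⟨ *-monoˡ-≤ (1# - β) 0≤1-β ν₂≤ν₁ ⟩
          (1# - β) * ν₁ z     ≈⟨ lazy-other β ν₁ (λ x≡z → z≢x (≡.sym x≡z)) ⟨
          lazy β x ν₁ z       ∎)

        zero⊎near′ : ∀ w → lazy β y ν₂ w ≈ 0# ⊎ (∀ u → D u w ≤ D u y + 1#)
        zero⊎near′ w with lem {w ≡ y}
        ... | yes ≡.refl = inj₂ λ u → ≤-slack 1# 0≤1 ≈-refl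
        ... | no  w≢y with zero⊎near w w≢y
        ...   | inj₂ near = inj₂ near
        ...   | inj₁ ν₂w≈0 =
              inj₁ (≈-trans (lazy-other β ν₂ λ y≡w → w≢y (≡.sym y≡w)) (≈-trans (*-congˡ ν₂w≈0) (zeroʳ _)))

        1-θ≤β : 1# - θ ≤ β
        1-θ≤β = ≤-slack (θ * α) (*-nonNegative (proj₁ 0<θ) 0≤α) (begin-equality
          β                                ≈⟨ solve 1 (λ β → β := :1 :- (:1 :- β)) ≈-refl β ⟩
          1# - (1# - β)                    ≈⟨ +-congˡ (-‿cong θ[1-α]≈1-β) ⟨
          1# - θ * (1# - α)
            ≈⟨ solve 2 (λ θ α → :1 :- θ :* (:1 :- α) := (:1 :- θ) :+ θ :* α) ≈-refl θ α ⟩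
          (1# - θ) + θ * α                 ∎)

        1-θ≤ : 1# - θ ≤ β - (1# - β) * ν₂ x
        1-θ≤ =
            ≤-slack (θ * (1# - (1# - α) * (1# + ν₂ x))) (*-nonNegative (proj₁ 0<θ) (a≤b⇒0≤b-a lazy-enough)) (begin-equality
          β - (1# - β) * ν₂ x
            ≈⟨ solve 2 (λ β n → β :- (:1 :- β) :* n := :1 :- (:1 :- β) :* (:1 :+ n)) ≈-refl β (ν₂ x) ⟩
          1# - (1# - β) * (1# + ν₂ x)
            ≈⟨ +-congˡ (-‿cong (*-congʳ θ[1-α]≈1-β)) ⟨
          1# - θ * (1# - α) * (1# + ν₂ x)
            ≈⟨ solve 3 (λ θ α n → :1 :- θ :* (:1 :- α) :* (:1 :+ n) := (:1 :- θ) :+ θ :* (:1 :- (:1 :- α) :* (:1 :+ n)))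
                 ≈-refl θ α (ν₂ x) ⟩
          (1# - θ) + θ * (1# - (1# - α) * (1# + ν₂ x)) ∎)

  -- Allows the exchange to start from whichever endpoint has the smaller degree.
  Reroutable-swap : ∀ {D m n x y t} → (∀ u v → D u v ≈ D v u) → Reroutable D n m y x t → Reroutable D m n x y t
  Reroutable-swap {D} D-sym r P = let P′ , t≤ , cost≤ = r (swapPlan P) in
    swapPlan P′ , t≤ , ≤-respˡ-≈ (cost-swap (mass P′))
                         (≤-respʳ-≈ (cost-swap (λ u v → mass P v u)) cost≤)
    where
    cost-swap : ∀ p → cost D p ≈ cost D (λ u v → p v u)
    cost-swap p = ≈-trans (SS-swap (λ u v → D u v * p u v)) (SS-cong λ u v _ _ → *-congʳ (D-sym v u))

-- Distances in hypergraphs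

-- `List⁺.last` goes through `initLast`, so the equation appears only after splitting on that view.
last-∷ : ∀ {A : Set} (e f : A) es → List⁺.last (e ∷ f ∷ es) ≡ List⁺.last (f ∷ es)
last-∷ e f es with initLast es
... | []      = ≡.refl
... | _ ∷ʳ′ _ = ≡.refl

module Distance (lem : ExcludedMiddle 0ℓ) (ℛ : CompleteOrderedField)
                (ℋ : Hypergraph) (locallyFinite : Hypergraph.LocallyFinite ℋ) where
  open Hypergraph ℋ
  open Extrema lem ℛ using (minimum; least)
  open Curvature lem ℛ ℋ locallyFinite using (distance)

  minimum-≤ : ∀ {P n} → P n → ∃ λ d → minimum P ≡ [ d ] × d ℕ.≤ n
  minimum-≤ {P} {n} Pn with lem {∃ P}
  ... | yes ∃P = _ , ≡.refl , proj₂ (proj₂ (least P ∃P)) n Pn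
  ... | no ¬∃P = contradiction (n , Pn) ¬∃P

  minimum-∈ : ∀ {P d} → minimum P ≡ [ d ] → P d
  minimum-∈ {P} eq with lem {∃ P}
  minimum-∈ {P} ≡.refl | yes ∃P = proj₁ (proj₂ (least P ∃P))

  -- Bundles finiteness with an upper bound, so that triangle inequalities need no arithmetic with
  -- ∞.
  Within : V → V → ℕ → Set
  Within u v k = ∃ λ d → distance u v ≡ [ d ] × d ℕ.≤ k

  distance-self : ∀ u → distance u u ≡ [ 0 ]
  distance-self u with lem {u ≡ u}
  ... | yes _   = ≡.refl
  ... | no  u≢u = contradiction ≡.refl u≢u

  within-self : ∀ u k → Within u u k
  within-self u k = 0 , distance-self u , z≤n

  within-path : ∀ {u v es} → IsHyperpath u v es → Within u v (List⁺.length es)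
  within-path {u} {v} {es} path with lem {u ≡ v}
  ... | yes _ = 0 , ≡.refl , z≤n
  ... | no  _ = minimum-≤ (es , path , ≡.refl)

  path-attaining : ∀ {u v d} → u ≢ v → distance u v ≡ [ d ] → ∃ λ es → IsHyperpath u v es × List⁺.length es ≡ d
  path-attaining {u} {v} u≢v eq with lem {u ≡ v}
  ... | yes u≡v = contradiction u≡v u≢v
  ... | no  _   = minimum-∈ eq

  singleton-path : ∀ {u v e} → u ∈ᴱ e → v ∈ᴱ e → IsHyperpath u v (e ∷ [])
  singleton-path u∈e v∈e = [] ∷ [] , u∈e , v∈e , [-]

  tail-path : ∀ {u v e f es} → IsHyperpath u v (e ∷ f ∷ es) →
              ∃ λ w → w ∈ᴱ e × IsHyperpath w v (f ∷ es)
  tail-path {v = v} {e} {f} {es} (_ ∷ unique , _ , v∈last , (w , w∈e , w∈f) ∷ linked) =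
    w , w∈e , unique , w∈f , ≡.subst (v ∈ᴱ_) (last-∷ e f es) v∈last , linked

  -- The hyperedges before `f` are dropped, and any vertex of `f` may start what remains.
  suffix-path : ∀ {u v w e f es} → IsHyperpath v w (e ∷ es) → f ∈ (e ∷ es) → u ∈ᴱ f →
                ∃ λ fs → IsHyperpath u w fs × List⁺.length fs ℕ.≤ suc (length es)
  suffix-path (unique , _ , w∈last , linked) (here ≡.refl) u∈f =
    _ , (unique , u∈f , w∈last , linked) , ℕₚ.≤-refl
  suffix-path {es = _ ∷ _} path (there f∈es) u∈f =
    let _ , _ , path′ = tail-path path
        fs , path″ , len≤ = suffix-path path′ f∈es u∈f
    in fs , path″ , ℕₚ.m≤n⇒m≤1+n len≤

  -- A hyperpath has distinct hyperedges, so `f` can be prepended to a shortest path only if it is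
  -- new. If it already occurs, the path is cut at `f`, which makes it no longer.
  within-stepˡ : ∀ {u v w f k} → u ∈ᴱ f → v ∈ᴱ f → Within v w k → Within u w (suc k)
  within-stepˡ {u} {v} {w} {f} {k} u∈f v∈f (d , eq , d≤k) with lem {v ≡ w}
  ... | yes ≡.refl = within-weaken (s≤s z≤n) (within-path (singleton-path u∈f v∈f))
    where
    within-weaken : ∀ {k l} → k ℕ.≤ l → Within u w k → Within u w l
    within-weaken k≤l (d , eq , d≤k) = d , eq , ℕₚ.≤-trans d≤k k≤l
  ... | no v≢w with minimum-∈ eq
  ...   | e ∷ es , path@(unique , v∈e , w∈last , linked) , ≡.refl with lem {f ∈ (e ∷ es)}
  ...     | yes f∈es = let fs , path′ , len≤ = suffix-path path f∈es u∈f
                           d′ , eq′ , d′≤ = within-path path′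
                       in d′ , eq′ , ℕₚ.≤-trans d′≤ (ℕₚ.≤-trans len≤ (ℕₚ.m≤n⇒m≤1+n d≤k))
  ...     | no f∉es  = let d′ , eq′ , d′≤ = within-path {es = f ∷ e ∷ es}
                             ( All.tabulate (λ g∈es f≡g → f∉es (≡.subst (_∈ (e ∷ es)) (≡.sym f≡g) g∈es)) ∷ unique
                             , u∈f , ≡.subst (w ∈ᴱ_) (≡.sym (last-∷ f e es)) w∈last
                             , (v , v∈f , v∈e) ∷ linked)
                       in d′ , eq′ , ℕₚ.≤-trans d′≤ (s≤s d≤k)

  -- Carries a bound on the distance to `s` from one hyperedge to the next. Started at s = u, it
  -- yields the symmetry of the distance without reversing a list.
  within-along : ∀ {s u v k} e es → IsHyperpath u v (e ∷ es) → Within u s k → Within v s (suc (length es) ℕ.+ k)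
  within-along e []       (_ , u∈e , v∈e , _) h = within-stepˡ v∈e u∈e h
  within-along {s} {v = v} {k} e (f ∷ es) path@(_ , u∈e , _) h =
    let w , w∈e , path′ = tail-path path in
    ≡.subst (Within v s) (≡.cong suc (ℕₚ.+-suc (length es) k)) (within-along f es path′ (within-stepˡ w∈e u∈e h))

  within-sym : ∀ {u v k} → Within u v k → Within v u k
  within-sym {u} {v} {k} (d , eq , d≤k) with lem {u ≡ v}
  ... | yes ≡.refl = within-self u k
  ... | no u≢v with minimum-∈ eq
  ...   | e ∷ es , path , ≡.refl =
    let d′ , eq′ , d′≤ = within-along e es path (within-self u 0) in
    d′ , eq′ , ℕₚ.≤-trans d′≤ (≡.subst (ℕ._≤ k) (≡.sym (ℕₚ.+-identityʳ _)) d≤k)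

  within-stepʳ : ∀ {u v w f k} → v ∈ᴱ f → w ∈ᴱ f → Within u v k → Within u w (suc k)
  within-stepʳ v∈f w∈f h = within-sym (within-stepˡ w∈f v∈f (within-sym h))

  within-∼ : ∀ {u v} → u ∼ v → Within u v 1
  within-∼ (_ , _ , u∈e , v∈e) = within-path (singleton-path u∈e v∈e)

  -- Infinite distances are replaced by 2, which keeps non-adjacent vertices at
  -- distance at least 2 and preserves the triangle inequality for adjacent ones.
  finiteDistance : ℕ ⁺ → ℕ
  finiteDistance [ d ] = d
  finiteDistance ⊤⁺    = 2

  dist : V → V → ℕ
  dist u v = finiteDistance (distance u v)

  within⇒dist≤ : ∀ {u v k} → Within u v k → dist u v ℕ.≤ k
  within⇒dist≤ (d , eq , d≤k) rewrite eq = d≤k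

  dist-self : ∀ u → dist u u ≡ 0
  dist-self u rewrite distance-self u = ≡.refl

  within-dist : ∀ {u v d} → distance u v ≡ [ d ] → Within u v (dist u v)
  within-dist {d = d} eq rewrite eq = d , ≡.refl , ℕₚ.≤-refl

  dist-sym : ∀ u v → dist u v ≡ dist v u
  dist-sym u v = by-cases (distance u v) ≡.refl (distance v u) ≡.refl
    where
    by-cases : ∀ a → distance u v ≡ a → ∀ b → distance v u ≡ b → dist u v ≡ dist v u
    by-cases ⊤⁺ eq ⊤⁺ eq′ = ≡.cong finiteDistance (≡.trans eq (≡.sym eq′))
    by-cases [ d ] eq b eq′ = ℕₚ.≤-antisym
      (within⇒dist≤ (within-sym (within-dist {v} {u} (proj₁ (proj₂ (within-sym (within-dist eq)))))))
      (within⇒dist≤ (within-sym (within-dist eq)))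
    by-cases ⊤⁺ eq [ d ] eq′ with ≡.trans (≡.sym eq) (proj₁ (proj₂ (within-sym (within-dist eq′))))
    ... | ()

  1≤dist : ∀ {u v} → u ≢ v → 1 ℕ.≤ dist u v
  1≤dist {u} {v} u≢v with distance u v in eq
  ... | ⊤⁺    = s≤s z≤n
  ... | [ d ] with path-attaining u≢v eq
  ...   | e ∷ es , _ , ≡.refl = s≤s z≤n

  2≤dist : ∀ {u v} → u ≢ v → ¬ u ∼ v → 2 ℕ.≤ dist u v
  2≤dist {u} {v} u≢v u≁v with distance u v in eq
  ... | ⊤⁺    = s≤s (s≤s z≤n)
  ... | [ d ] with path-attaining u≢v eq
  ...   | e ∷ _ ∷ _ , _ , ≡.refl                 = s≤s (s≤s z≤n)
  ...   | e ∷ []    , (_ , u∈e , v∈e , _) , _ = contradiction (u≢v , e , u∈e , v∈e) u≁v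

  distance-∼ : ∀ {u v} → u ∼ v → distance u v ≡ [ 1 ]
  distance-∼ {u} {v} u∼v = let d , eq , d≤1 = within-∼ u∼v in ≡.trans eq (≡.cong [_]
    (ℕₚ.≤-antisym d≤1 (≡.subst (λ a → 1 ℕ.≤ finiteDistance a) eq (1≤dist (proj₁ u∼v)))))

  dist-∼ : ∀ {u v} → u ∼ v → dist u v ≡ 1
  dist-∼ u∼v = ≡.cong finiteDistance (distance-∼ u∼v)

  dist-step : ∀ {v w} → v ∼ w → ∀ u → dist u w ℕ.≤ suc (dist u v)
  dist-step {v} {w} (_ , f , v∈f , w∈f) u = by-cases (distance u v) ≡.refl (distance u w) ≡.refl
    where
    by-cases : ∀ a → distance u v ≡ a → ∀ b → distance u w ≡ b → dist u w ℕ.≤ suc (dist u v)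
    by-cases [ d ] eq b     eq′ = within⇒dist≤ (within-stepʳ v∈f w∈f (within-dist eq))
    by-cases ⊤⁺    eq ⊤⁺    eq′ = ≡.subst₂ (λ a b → finiteDistance a ℕ.≤ suc (finiteDistance b))
      (≡.sym eq′) (≡.sym eq) (s≤s (s≤s z≤n))
    by-cases ⊤⁺    eq [ d ] eq′ with ≡.trans (≡.sym eq) (proj₁ (proj₂ (within-stepʳ w∈f v∈f (within-dist eq′))))
    ... | ()

-- The random walk

module RandomWalk (lem : ExcludedMiddle 0ℓ) (ℛ : CompleteOrderedField)
                  (ℋ : Hypergraph) (locallyFinite : Hypergraph.LocallyFinite ℋ)
                  (simple : Hypergraph.Simple ℋ) where
  open Hypergraph ℋ
  open OrderedField ℛ
  open FiniteSums lem ℛ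
  open Curvature lem ℛ ℋ locallyFinite using (star; degree; μ)
  open Solver using (solve; _:+_; _:*_; _:-_; _:=_; :0; :1)

  ∈-star : ∀ {x e} → x ∈ᴱ e → e ∈ star x
  ∈-star {x} {e} = Equivalence.from (proj₂ (proj₂ (locallyFinite x)) e)

  ∈-star⁻ : ∀ {x e} → e ∈ star x → x ∈ᴱ e
  ∈-star⁻ {x} {e} = Equivalence.to (proj₂ (proj₂ (locallyFinite x)) e)

  star-unique : ∀ x → Unique (star x)
  star-unique x = proj₁ (proj₂ (locallyFinite x))

  ∼-sym : ∀ {x y} → x ∼ y → y ∼ x
  ∼-sym (x≢y , e , x∈e , y∈e) = (λ y≡x → x≢y (≡.sym y≡x)) , e , y∈e , x∈e

  0<degree : ∀ {x z} → x ∼ z → 0# < fromℕ (degree x)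
  0<degree {x} (_ , e , x∈e , _) with star x | ∈-star x∈e
  ... | _ ∷ es | _ = 0<fromℕ[1+n] (length es)

  weight : E → Carrier
  weight e = (fromℕ ∣ e ∣ - 1#) ⁻¹

  0<fromℕ-1 : ∀ {n} → 2 ℕ.≤ n → 0# < fromℕ n - 1#
  0<fromℕ-1 {suc (suc n)} (s≤s (s≤s _)) with 0<fromℕ[1+n] n
  ... | 0≤ , 0≉ = ≤-respʳ-≈ (≈-sym eq) 0≤ , λ 0≈ → 0≉ (≈-trans 0≈ eq)
    where
    eq : (1# + fromℕ (suc n)) - 1# ≈ fromℕ (suc n)
    eq = solve 1 (λ n → (:1 :+ n) :- :1 := n) ≈-refl (fromℕ (suc n))

  0<∣e∣-1 : ∀ e → 0# < fromℕ ∣ e ∣ - 1#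
  0<∣e∣-1 e = 0<fromℕ-1 (proj₁ simple e)

  0≤weight : ∀ e → 0# ≤ weight e
  0≤weight e = 0≤x⁻¹ (0<∣e∣-1 e)

  -- The indicator of membership, encoded as a sum of deltas so that summing it over vertices is an
  -- exchange of finite sums.
  ι : V → E → Carrier
  ι z e = S (vertices e) (δ z)

  ι-∈ : ∀ {z e} → z ∈ᴱ e → ι z e ≈ 1#
  ι-∈ {e = e} = S-δ (unique e)

  0≤ι : ∀ z e → 0# ≤ ι z e
  0≤ι z e = S-nonNegative (vertices e) λ v _ → 0≤δ z v

  ι-∉ : ∀ {z e} → ¬ z ∈ᴱ e → ι z e ≈ 0#
  ι-∉ = S-δ-∉

  S-filter : ∀ z es → S (filter (λ e → lem {z ∈ᴱ e}) es) weight ≈ S es (λ e → ι z e * weight e)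
  S-filter z []       = ≈-refl
  S-filter z (e ∷ es) with lem {z ∈ᴱ e}
  ... | yes z∈e = +-cong (≈-sym (≈-trans (*-congʳ (ι-∈ z∈e)) (*-identityˡ _))) (S-filter z es)
  ... | no  z∉e =
        ≈-trans (S-filter z es) (≈-sym (≈-trans (+-congʳ (≈-trans (*-congʳ (ι-∉ z∉e)) (zeroˡ _))) (+-identityˡ _)))

  share : V → V → Carrier
  share x z = fromℕ (degree x) ⁻¹ * S (star x) (λ e → ι z e * weight e)

  -- The random walk without idleness. The formula in `share` would also give mass to `x` itself,
  -- which lies in all its hyperedges; the first factor removes it.
  ν : V → V → Carrier
  ν x z = (1# - δ x z) * share x z

  ν-self : ∀ x → ν x x ≈ 0#
  ν-self x = ≈-trans (*-congʳ (+-congˡ (-‿cong (δ-refl x))))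
    (solve 1 (λ a → (:1 :- :1) :* a := :0) ≈-refl (share x x))

  ν-≢ : ∀ {x z} → x ≢ z → ν x z ≈ share x z
  ν-≢ x≢z = ≈-trans (*-congʳ (+-congˡ (-‿cong (δ-≢ x≢z))))
    (solve 1 (λ a → (:1 :- :0) :* a := a) ≈-refl (share _ _))

  ν-≁ : ∀ {x z} → ¬ z ∼ x → ν x z ≈ 0#
  ν-≁ {x} {z} z≁x with lem {x ≡ z}
  ... | yes ≡.refl = solve 1 (λ a → (:1 :- :1) :* a := :0) ≈-refl (share x x)
  ... | no x≢z = ≈-trans (*-congˡ (≈-trans (*-congˡ (≈-trans (S-cong (star x) λ e e∈ →
    ≈-trans (*-congʳ (ι-∉ λ z∈e → z≁x ((λ z≡x → x≢z (≡.sym z≡x)) , e , z∈e , ∈-star⁻ e∈))) (zeroˡ _))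
    (S-zero (star x)))) (zeroʳ _))) (zeroʳ _)

  0≤ν : ∀ x z → 0# ≤ ν x z
  0≤ν x z with lem {z ∼ x}
  ... | no  z≁x = ≤-reflexive (≈-sym (ν-≁ z≁x))
  ... | yes z∼x = ≤-respʳ-≈ (≈-sym (ν-≢ (λ x≡z → proj₁ z∼x (≡.sym x≡z))))
    (*-nonNegative (0≤x⁻¹ (0<degree (∼-sym z∼x)))
      (S-nonNegative (star x) λ e _ → *-nonNegative (0≤ι z e) (0≤weight e)))

  μ≈lazy : ∀ α x z → μ α x z ≈ α * δ x z + (1# - α) * ν x z
  μ≈lazy α x z with lem {z ≡ x} | lem {z ∼ x}
  ... | yes ≡.refl | _ = ≈-sym (≈-trans (+-cong (*-congˡ (δ-refl x)) (*-congˡ (ν-self x)))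
    (solve 1 (λ α → α :* :1 :+ (:1 :- α) :* :0 := α) ≈-refl α))
  ... | no z≢x | yes z∼x = ≈-sym (≈-trans (+-cong (*-congˡ (δ-≢ λ x≡z → z≢x (≡.sym x≡z)))
      (*-congˡ (≈-trans (ν-≢ λ x≡z → z≢x (≡.sym x≡z)) (*-congˡ (≈-sym (S-filter z (star x)))))))
    (solve 3 (λ α d s → α :* :0 :+ (:1 :- α) :* (d :* s) := (:1 :- α) :* d :* s) ≈-refl α _ _))
  ... | no z≢x | no z≁x = ≈-sym (≈-trans (+-cong (*-congˡ (δ-≢ λ x≡z → z≢x (≡.sym x≡z))) (*-congˡ (ν-≁ z≁x)))
    (solve 1 (λ α → α :* :0 :+ (:1 :- α) :* :0 := :0) ≈-refl α))

  module _ {L : List V} (L-unique : Unique L) where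
    open Transport lem ℛ L L-unique using (S-erase)

    -- A hyperedge at `x` gives weight 1 / (|e| - 1) to each of its |e| vertices; without `x` itself
    -- its contribution is 1. Adding up over the star and dividing by the degree gives 1.
    S-ν : ∀ {x y} → x ∼ y → (∀ {e} → x ∈ᴱ e → ∀ v → v ∈ᴱ e → v ∈ L) → S L (ν x) ≈ 1#
    S-ν {x} x∼y@(_ , e₀ , x∈e₀ , _) covers = begin-equality
      S L (ν x)                        ≈⟨ S-erase (covers x∈e₀ x x∈e₀) (share x) ⟩
      S L (share x) - share x x        ≈⟨ +-cong whole (-‿cong own) ⟩
      d⁻¹ * S (star x) (λ e → fromℕ ∣ e ∣ * weight e) - d⁻¹ * S (star x) weight
        ≈⟨ solve 3 (λ d a b → d :* a :- d :* b := d :* (a :- b)) ≈-refl d⁻¹ _ _ ⟩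
      d⁻¹ * (S (star x) (λ e → fromℕ ∣ e ∣ * weight e) - S (star x) weight)
        ≈⟨ *-congˡ (S-minus (star x) _ _) ⟨
      d⁻¹ * S (star x) (λ e → fromℕ ∣ e ∣ * weight e - weight e)
        ≈⟨ *-congˡ (S-cong (star x) λ e _ → ≈-trans
             (solve 2 (λ n w → n :* w :- w := (n :- :1) :* w) ≈-refl (fromℕ ∣ e ∣) (weight e))
             (*-inverseʳ _ (0<x⇒x≉0 (0<∣e∣-1 e)))) ⟩
      d⁻¹ * S (star x) (λ _ → 1#)      ≈⟨ *-congˡ (S-one (star x)) ⟩
      d⁻¹ * fromℕ (degree x)           ≈⟨ *-comm _ _ ⟩
      fromℕ (degree x) * d⁻¹           ≈⟨ *-inverseʳ _ (0<x⇒x≉0 (0<degree x∼y)) ⟩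
      1#                               ∎
      where
      open ≤-Reasoning
      d⁻¹ = fromℕ (degree x) ⁻¹

      size : ∀ {e} → e ∈ star x → S L (λ z → ι z e) ≈ fromℕ ∣ e ∣
      size {e} e∈ = begin-equality
        S L (λ z → S (vertices e) (δ z))           ≈⟨ S-swap L (vertices e) δ ⟩
        S (vertices e) (λ v → S L λ z → δ z v)     ≈⟨ S-cong (vertices e) (λ v v∈e →
          ≈-trans (S-cong L λ z _ → δ-sym z v) (S-δ L-unique (covers (∈-star⁻ e∈) v v∈e))) ⟩
        S (vertices e) (λ _ → 1#)                  ≈⟨ S-one (vertices e) ⟩
        fromℕ ∣ e ∣                                ∎

      whole : S L (share x) ≈ d⁻¹ * S (star x) (λ e → fromℕ ∣ e ∣ * weight e)
      whole = ≈-trans (S-*ˡ L d⁻¹ _) (*-congˡ (≈-trans (S-swap L (star x) (λ z e → ι z e * weight e))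
        (S-cong (star x) λ e e∈ → ≈-trans (S-*ʳ L (weight e) (λ z → ι z e)) (*-congʳ (size e∈)))))

      own : share x x ≈ d⁻¹ * S (star x) weight
      own = *-congˡ (S-cong (star x) λ e e∈ → ≈-trans (*-congʳ (ι-∈ (∈-star⁻ e∈))) (*-identityˡ _))

  -- By linearity only one hyperedge contains both vertices, so a single term of the sum survives.
  ν-linear : ∀ {r} → Uniform r → Linear → ∀ {x z} → z ∼ x → ν x z ≈ fromℕ (degree x) ⁻¹ * (fromℕ r - 1#) ⁻¹
  ν-linear {r} uniform linear {x} {z} (z≢x , e₀ , z∈e₀ , x∈e₀) =
      ≈-trans (ν-≢ λ x≡z → z≢x (≡.sym x≡z)) (*-congˡ (begin-equality
    S (star x) (λ e → ι z e * weight e)      ≈⟨ S-cong (star x) (λ e e∈ → *-cong (ι≈δ e e∈) (weight≈ e)) ⟩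
    S (star x) (λ e → δ e₀ e * (fromℕ r - 1#) ⁻¹)
      ≈⟨ S-δ* (star-unique x) (∈-star x∈e₀) (λ _ → (fromℕ r - 1#) ⁻¹) ⟩
    (fromℕ r - 1#) ⁻¹                        ∎))
    where
    open ≤-Reasoning
    weight≈ : ∀ e → weight e ≈ (fromℕ r - 1#) ⁻¹
    weight≈ e rewrite uniform e = ≈-refl

    ι≈δ : ∀ e → e ∈ star x → ι z e ≈ δ e₀ e
    ι≈δ e e∈ with lem {e₀ ≡ e}
    ... | yes ≡.refl = ι-∈ z∈e₀
    ... | no  e₀≢e   = ι-∉ λ z∈e → z≢x (linear e₀ e e₀≢e z x z∈e₀ z∈e x∈e₀ (∈-star⁻ e∈))

-- Sums in [0,∞] and the Wasserstein distance

module InfiniteSums (lem : ExcludedMiddle 0ℓ) (ℛ : CompleteOrderedField) where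
  open OrderedField ℛ
  open FiniteSums lem ℛ
  open Extrema lem ℛ

  -- Finiteness together with a real value, independent of the nonnegativity proof inside [0,∞]; it
  -- has the shape of the marginal conditions of a coupling.
  HasValue : [0,∞] → Carrier → Set
  HasValue a r = ∃ λ m → a ≈∞ [ m ] × proj₁ m ≈ r

  value-nonNegative : ∀ {a r} → HasValue a r → 0# ≤ r
  value-nonNegative ((_ , 0≤m) , _ , m≈r) = ≤-respʳ-≈ m≈r 0≤m

  value : ∀ {r} (0≤r : 0# ≤ r) → HasValue [ r , 0≤r ] r
  value 0≤r = (_ , 0≤r) , PointEquality.[ ≈-refl ] , ≈-refl

  value-≈ : ∀ {a r s} → r ≈ s → HasValue a r → HasValue a s
  value-≈ r≈s (m , eq , m≈r) = m , eq , ≈-trans m≈r r≈s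

  value-≤ : ∀ {a b r s} → HasValue a r → HasValue b s → r ≤ s → a ≤∞ b
  value-≤ (_ , PointEquality.[ a≈m ] , m≈r) (_ , PointEquality.[ b≈n ] , n≈s) r≤s =
    [ ≤-respˡ-≈ (≈-sym (≈-trans a≈m m≈r)) (≤-respʳ-≈ (≈-sym (≈-trans b≈n n≈s)) r≤s) ]≤

  value-≤⁻ : ∀ {a b r s} → HasValue a r → HasValue b s → a ≤∞ b → r ≤ s
  value-≤⁻ (_ , PointEquality.[ a≈m ] , m≈r) (_ , PointEquality.[ b≈n ] , n≈s) [ a≤b ]≤ =
    ≤-respˡ-≈ (≈-trans a≈m m≈r) (≤-respʳ-≈ (≈-trans b≈n n≈s) a≤b)

  value-unique : ∀ {a r s} → HasValue a r → HasValue a s → r ≈ s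
  value-unique (_ , PointEquality.[ a≈m ] , m≈r) (_ , PointEquality.[ a≈n ] , n≈s) =
    ≈-trans (≈-sym (≈-trans a≈m m≈r)) (≈-trans a≈n n≈s)

  value-+ : ∀ {a b r s} → HasValue a r → HasValue b s → HasValue (a +∞ b) (r + s)
  value-+ ((_ , 0≤m) , PointEquality.[ a≈m ] , m≈r) ((_ , 0≤n) , PointEquality.[ b≈n ] , n≈s) =
    (_ , +-nonNegative 0≤m 0≤n) , PointEquality.[ +-cong a≈m b≈n ] , +-cong m≈r n≈s

  ≤-finite : ∀ {a b s} → HasValue b s → a ≤∞ b → ∃ λ r → HasValue a r
  ≤-finite {[ r , 0≤r ]} _ _ = r , value 0≤r
  ≤-finite {⊤⁺} (_ , () , _) (_ ≤⊤⁺)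

  value-antisym : ∀ {a b s} → HasValue b s → a ≤∞ b → b ≤∞ a → HasValue a s
  value-antisym b-value a≤b b≤a = let r , a-value = ≤-finite b-value a≤b in
    value-≈ (antisym (value-≤⁻ a-value b-value a≤b) (value-≤⁻ b-value a-value b≤a)) a-value

  module _ {A : Set} (f : A → [0,∞]) (g : A → Carrier) (f-value : ∀ a → HasValue (f a) (g a)) where

    partialSum-value : ∀ as → HasValue (foldr _+∞_ 0∞ (map f as)) (S as g)
    partialSum-value []       = value ≤-refl
    partialSum-value (a ∷ as) = value-+ (f-value a) (partialSum-value as)

    private
      sup = proj₂ (supremum {∃ λ (as : List A) → Unique as} (λ (as , _) → foldr _+∞_ 0∞ (map f as)))

    -- `L` is itself one of the lists in the supremum, and `S⊆-≤` shows that no other list gives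
    -- more.
    ∑-value : ∀ {L} → Unique L → (∀ a → a ∉ L → g a ≈ 0#) → HasValue (∑ f) (S L g)
    ∑-value {L} L-unique g≈0 = value-antisym (partialSum-value L)
      (proj₂ sup _ λ (as , as-unique) → value-≤ (partialSum-value as) (partialSum-value L)
        (S⊆-≤ as-unique L-unique (λ a → value-nonNegative (f-value a)) g≈0))
      (proj₁ sup (L , L-unique))

    -- A single term is the partial sum of a one-element list. This forces a coupling to vanish
    -- wherever a marginal does.
    term≤∑ : ∀ {r} → HasValue (∑ f) r → ∀ a → g a ≤ r
    term≤∑ ∑-value a = ≤-respˡ-≈ (+-identityʳ (g a))
      (value-≤⁻ (partialSum-value (a ∷ [])) ∑-value (proj₁ sup (a ∷ [] , [] ∷ [])))

-- Couplings on the whole vertex set versus plans on a finite list.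

module Wasserstein (lem : ExcludedMiddle 0ℓ) (ℛ : CompleteOrderedField)
                   (ℋ : Hypergraph) (locallyFinite : Hypergraph.LocallyFinite ℋ)
                   {L : List (Hypergraph.V ℋ)} (L-unique : Unique L) where
  open Hypergraph ℋ
  open OrderedField ℛ
  open FiniteSums lem ℛ
  open InfiniteSums lem ℛ
  open Transport lem ℛ L L-unique
  open LazyTransport lem ℛ L L-unique
  open Distance lem ℛ ℋ locallyFinite
  open Extrema lem ℛ
  open Curvature lem ℛ ℋ locallyFinite using (distance; Coupling; W₁)

  D : V → V → Carrier
  D u v = fromℕ (dist u v)

  module _ (D-finite : ∀ u v → u ∈ L → v ∈ L → ∃ λ d → distance u v ≡ [ d ]) where

    -- Two vertices of `L` are never at infinite distance. Where the distance is infinite, `x` is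
    -- therefore zero, and the convention ∞ · 0 = 0 agrees with the finite stand-in used by `D`.
    distance·-value : ∀ u v x (0≤x : 0# ≤ x) → (u ∉ L ⊎ v ∉ L → x ≈ 0#) →
                      HasValue (distance u v · (x , 0≤x)) (D u v * x)
    distance·-value u v x 0≤x x≈0 = by-cases (distance u v) ≡.refl
      where
      by-cases : ∀ d → distance u v ≡ d → HasValue (d · (x , 0≤x)) (fromℕ (finiteDistance d) * x)
      by-cases [ d ] _  = value _
      by-cases ⊤⁺    eq with lem {x ≈ 0#}
      ... | yes x≈0 = value-≈ (≈-sym (≈-trans (*-congˡ x≈0) (zeroʳ _))) (value ≤-refl)
      ... | no  x≉0 with lem {u ∈ L} | lem {v ∈ L}
      ...   | no u∉L  | _       = contradiction (x≈0 (inj₁ u∉L)) x≉0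
      ...   | yes _   | no v∉L  = contradiction (x≈0 (inj₂ v∉L)) x≉0
      ...   | yes u∈L | yes v∈L with ≡.trans (≡.sym eq) (proj₂ (D-finite u v u∈L v∈L))
      ...     | ()

    module _ {μ₁ μ₂ m n : V → Carrier}
             (μ₁≈m : ∀ u → μ₁ u ≈ m u) (μ₂≈n : ∀ v → μ₂ v ≈ n v)
             (m≈0 : ∀ u → u ∉ L → m u ≈ 0#) (n≈0 : ∀ v → v ∉ L → n v ≈ 0#) where

      module FromCoupling (C : Coupling μ₁ μ₂) where
        open Coupling C

        π-value : ∀ u v → HasValue (π∞ u v) (π u v)
        π-value u v = value (0≤π u v)

        π≈0 : ∀ u v → u ∉ L ⊎ v ∉ L → π u v ≈ 0#
        π≈0 u v (inj₁ u∉L) = squeeze (0≤π u v)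
          (term≤∑ (λ w → π∞ u w) (π u) (π-value u) (value-≈ (≈-trans (μ₁≈m u) (m≈0 u u∉L)) (marginal₁ u)) v) ≈-refl
        π≈0 u v (inj₂ v∉L) = squeeze (0≤π u v)
          (term≤∑ (λ w → π∞ w v) (λ w → π w v) (λ w → π-value w v) (value-≈ (≈-trans (μ₂≈n v) (n≈0 v v∉L)) (marginal₂ v)) u) ≈-refl

        plan : Plan m n
        plan = record
          { mass   = π
          ; 0≤mass = λ u v _ _ → 0≤π u v
          ; rows   = λ u _ → ≈-trans (value-unique
              (∑-value (λ w → π∞ u w) (π u) (π-value u) L-unique λ w w∉L → π≈0 u w (inj₂ w∉L)) (marginal₁ u)) (μ₁≈m u)
          ; cols   = λ v _ → ≈-trans (value-unique
              (∑-value (λ w → π∞ w v) (λ w → π w v) (λ w → π-value w v) L-unique λ w w∉L → π≈0 w v (inj₁ w∉L))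
              (marginal₂ v)) (μ₂≈n v)
          }

      cost-value : (C : Coupling μ₁ μ₂) → HasValue (Coupling.cost C) (Transport.cost lem ℛ L L-unique D (Coupling.π C))
      cost-value C = ∑-value _ (λ u → S L λ v → D u v * π u v)
        (λ u → ∑-value _ (λ v → D u v * π u v) (λ v → distance·-value u v (π u v) (0≤π u v) (π≈0 u v)) L-unique
          λ v v∉L → ≈-trans (*-congˡ (π≈0 u v (inj₂ v∉L))) (zeroʳ _)) L-unique
        λ u u∉L → ≈-trans (S-cong L λ v _ → ≈-trans (*-congˡ (π≈0 u v (inj₁ u∉L))) (zeroʳ _)) (S-zero L)
        where
        open Coupling C
        open FromCoupling C

      module FromPlan (P : Plan m n) (n≤1 : ∀ v → n v ≤ 1#) where
        ind : V → Carrier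
        ind u = S L (δ u)

        -- A plan is constrained on `L` only, so it is cut off by indicators to become a coupling on
        -- all of V.
        π : V → V → Carrier
        π u v = ind u * (ind v * mass P u v)

        ind-∈ : ∀ {u} → u ∈ L → ind u ≈ 1#
        ind-∈ = S-δ L-unique

        ind-∉ : ∀ {u} → u ∉ L → ind u ≈ 0#
        ind-∉ = S-δ-∉

        π≈mass : ∀ u v → u ∈ L → v ∈ L → π u v ≈ mass P u v
        π≈mass u v u∈L v∈L =
            ≈-trans (*-cong (ind-∈ u∈L) (≈-trans (*-congʳ (ind-∈ v∈L)) (*-identityˡ _))) (*-identityˡ _)

        π≈0 : ∀ u v → u ∉ L ⊎ v ∉ L → π u v ≈ 0#
        π≈0 u v (inj₁ u∉L) = ≈-trans (*-congʳ (ind-∉ u∉L)) (zeroˡ _)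
        π≈0 u v (inj₂ v∉L) = ≈-trans (*-congˡ (≈-trans (*-congʳ (ind-∉ v∉L)) (zeroˡ _))) (zeroʳ _)

        0≤π : ∀ u v → 0# ≤ π u v
        0≤π u v with lem {u ∈ L} | lem {v ∈ L}
        ... | no u∉L  | _       = ≤-reflexive (≈-sym (π≈0 u v (inj₁ u∉L)))
        ... | yes _   | no v∉L  = ≤-reflexive (≈-sym (π≈0 u v (inj₂ v∉L)))
        ... | yes u∈L | yes v∈L = ≤-respʳ-≈ (≈-sym (π≈mass u v u∈L v∈L)) (0≤mass P u v u∈L v∈L)

        row : ∀ u → S L (π u) ≈ m u
        row u with lem {u ∈ L}
        ... | yes u∈L = ≈-trans (S-cong L λ v v∈L → π≈mass u v u∈L v∈L) (rows P u u∈L)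
        ... | no  u∉L = ≈-trans (≈-trans (S-cong L λ v _ → π≈0 u v (inj₁ u∉L)) (S-zero L)) (≈-sym (m≈0 u u∉L))

        col : ∀ v → S L (λ u → π u v) ≈ n v
        col v with lem {v ∈ L}
        ... | yes v∈L = ≈-trans (S-cong L λ u u∈L → π≈mass u v u∈L v∈L) (cols P v v∈L)
        ... | no  v∉L = ≈-trans (≈-trans (S-cong L λ u _ → π≈0 u v (inj₂ v∉L)) (S-zero L)) (≈-sym (n≈0 v v∉L))

        π≤1 : ∀ u v → π u v ≤ 1#
        π≤1 u v with lem {u ∈ L}
        ... | no u∉L  = ≤-respˡ-≈ (≈-sym (π≈0 u v (inj₁ u∉L))) 0≤1
        ... | yes u∈L = ≤-trans (≤-respʳ-≈ (col v) (term≤S (λ w _ → 0≤π w v) u∈L)) (n≤1 v)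

        coupling : Coupling μ₁ μ₂
        coupling = record
          { π   = π
          ; 0≤π = 0≤π
          ; π≤1 = π≤1
          ; marginal₁ = λ u → value-≈ (≈-trans (row u) (≈-sym (μ₁≈m u)))
              (∑-value _ (π u) (λ v → value (0≤π u v)) L-unique λ v v∉L → π≈0 u v (inj₂ v∉L))
          ; marginal₂ = λ v → value-≈ (≈-trans (col v) (≈-sym (μ₂≈n v)))
              (∑-value _ (λ u → π u v) (λ u → value (0≤π u v)) L-unique λ u u∉L → π≈0 u v (inj₁ u∉L))
          }

        coupling-cost-value : HasValue (Coupling.cost coupling) (Transport.cost lem ℛ L L-unique D (mass P))
        coupling-cost-value =
            value-≈ (SS-cong λ u v u∈L v∈L → *-congˡ (π≈mass u v u∈L v∈L)) (cost-value coupling)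

      module _ (n≤1 : ∀ v → n v ≤ 1#) (P₀ : Plan m n) {W : [0,∞]}
               (W-infimum : IsInfimum (Coupling.cost {μ₁} {μ₂}) W) where
        open FromPlan using (coupling; coupling-cost-value)

        private
          W-finite : ∃ λ w → HasValue W w
          W-finite = ≤-finite (coupling-cost-value P₀ n≤1) (proj₁ W-infimum (coupling P₀ n≤1))

        infimum-value : ∃ λ w → HasValue W w × IsCostInfimum D m n w
        infimum-value = let w , W-value = W-finite in
          w , W-value ,
          (λ P → value-≤⁻ W-value (coupling-cost-value P n≤1) (proj₁ W-infimum (coupling P n≤1))) ,
          λ c c≤ → greatest W-value c c≤ (total c 0#)
          where
          -- Lower bounds in [0,∞] are nonnegative while `c` is any real; a negative `c` is below
          -- the infimum because the infimum is nonnegative.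
          greatest : ∀ {w} → HasValue W w → ∀ c → (∀ (P : Plan m n) → c ≤ cost D (mass P)) → c ≤ 0# ⊎ 0# ≤ c → c ≤ w
          greatest W-value c c≤ (inj₁ c≤0) = ≤-trans c≤0 (value-nonNegative W-value)
          greatest W-value c c≤ (inj₂ 0≤c) = value-≤⁻ (value 0≤c) W-value
            (proj₂ W-infimum [ c , 0≤c ] λ C → value-≤ (value 0≤c) (cost-value C) (c≤ (FromCoupling.plan C)))

      W₁-value : (∀ v → n v ≤ 1#) → Plan m n → ∃ λ w → HasValue (W₁ μ₁ μ₂) w × IsCostInfimum D m n w
      W₁-value n≤1 P₀ = infimum-value n≤1 P₀ (proj₂ (infimum (Coupling.cost {μ₁} {μ₂})))

-- Curvature of adjacent vertices

module AdjacentVertices (lem : ExcludedMiddle 0ℓ) (ℛ : CompleteOrderedField)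
                        (ℋ : Hypergraph) (locallyFinite : Hypergraph.LocallyFinite ℋ)
                        (simple : Hypergraph.Simple ℋ) where
  open Hypergraph ℋ
  open OrderedField ℛ
  open FiniteSums lem ℛ
  open InfiniteSums lem ℛ using (HasValue; value-unique)
  open Distance lem ℛ ℋ locallyFinite
  open RandomWalk lem ℛ ℋ locallyFinite simple
  open Curvature lem ℛ ℋ locallyFinite
  open Solver using (solve; _:+_; _:*_; _:-_; _:=_; :0; :1)

  module _ {x y : V} (x∼y : x ∼ y) where

    private
      x≢y = proj₁ x∼y

    _≟_ : DecidableEquality V
    u ≟ v = lem {u ≡ v}

    -- All vertices of hyperedges through `x` or `y`: a finite list that contains both supports for
    -- every idleness.
    L : List V
    L = deduplicate _≟_ (concatMap vertices (star x ++ star y))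

    L-unique : Unique L
    L-unique = UniqueDec.deduplicate-! _≟_ _

    open Transport lem ℛ L L-unique
    open LazyTransport lem ℛ L L-unique
    open Wasserstein lem ℛ ℋ locallyFinite L-unique

    ∈-L⁺ : ∀ {e} → e ∈ star x ++ star y → ∀ v → v ∈ᴱ e → v ∈ L
    ∈-L⁺ e∈ v v∈e = ∈-deduplicate⁺ _≟_ (∈-concatMap⁺ vertices (lose e∈ v∈e))

    covers-x : ∀ {e} → x ∈ᴱ e → ∀ v → v ∈ᴱ e → v ∈ L
    covers-x x∈e = ∈-L⁺ (∈-++⁺ˡ (∈-star x∈e))

    covers-y : ∀ {e} → y ∈ᴱ e → ∀ v → v ∈ᴱ e → v ∈ L
    covers-y y∈e = ∈-L⁺ (∈-++⁺ʳ (star x) (∈-star y∈e))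

    ∈-L⁻ : ∀ {v} → v ∈ L → ∃ λ e → v ∈ᴱ e × (x ∈ᴱ e ⊎ y ∈ᴱ e)
    ∈-L⁻ {v} v∈L with find (∈-concatMap⁻ vertices {xs = star x ++ star y} (∈-deduplicate⁻ _≟_ _ v∈L))
    ... | e , e∈ , v∈e with ∈-++⁻ (star x) e∈
    ...   | inj₁ e∈x = e , v∈e , inj₁ (∈-star⁻ e∈x)
    ...   | inj₂ e∈y = e , v∈e , inj₂ (∈-star⁻ e∈y)

    x∈L : x ∈ L
    x∈L = let _ , _ , x∈e , _ = x∼y in covers-x x∈e x x∈e

    y∈L : y ∈ L
    y∈L = let _ , _ , x∈e , y∈e = x∼y in covers-x x∈e y y∈e

    D-finite : ∀ u v → u ∈ L → v ∈ L → ∃ λ d → distance u v ≡ [ d ]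
    D-finite u v u∈L v∈L = let d , eq , _ = to-v in d , eq
      where
      e₀   = proj₁ (proj₂ x∼y)
      x∈e₀ = proj₁ (proj₂ (proj₂ x∼y))
      y∈e₀ = proj₂ (proj₂ (proj₂ x∼y))

      to-x : Within u x 2
      to-x with ∈-L⁻ u∈L
      -- The outer step from `x` to itself is padding: it gives both cases the same bound 2.
      ... | e , u∈e , inj₁ x∈e = within-stepʳ x∈e x∈e (within-stepʳ u∈e x∈e (within-self u 0))
      ... | e , u∈e , inj₂ y∈e = within-stepʳ y∈e₀ x∈e₀ (within-stepʳ u∈e y∈e (within-self u 0))

      to-v : ∃ λ d → distance u v ≡ [ d ] × d ℕ.≤ 4
      to-v with ∈-L⁻ v∈L
      ... | e , v∈e , inj₁ x∈e = within-stepʳ v∈e v∈e (within-stepʳ x∈e v∈e to-x)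
      ... | e , v∈e , inj₂ y∈e = within-stepʳ y∈e v∈e (within-stepʳ x∈e₀ y∈e₀ to-x)

    Sνx≈1 : S L (ν x) ≈ 1#
    Sνx≈1 = S-ν L-unique x∼y covers-x

    Sνy≈1 : S L (ν y) ≈ 1#
    Sνy≈1 = S-ν L-unique (∼-sym x∼y) covers-y

    lazy-∉ : ∀ {z} α → (∀ {e} → z ∈ᴱ e → ∀ v → v ∈ᴱ e → v ∈ L) → z ∈ L → ∀ v → v ∉ L → lazy α z (ν z) v ≈ 0#
    lazy-∉ {z} α covers z∈L v v∉L = ≈-trans (lazy-other α (ν z) λ z≡v → v∉L (≡.subst (_∈ L) z≡v z∈L))
      (≈-trans (*-congˡ (ν-≁ λ (_ , e , v∈e , z∈e) → v∉L (covers z∈e v v∈e))) (zeroʳ _))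

    Dxy≈1 : D x y ≈ 1#
    Dxy≈1 rewrite dist-∼ x∼y = +-identityʳ 1#

    -- k is the value of κ_α(x,y) / (1 - α).
    record ScaledCurvature (α k : Carrier) : Set where
      field
        cost∞    : Carrier
        W-value  : HasValue (W₁ (μ α x) (μ α y)) cost∞
        infimum∞ : IsCostInfimum D (lazy α x (ν x)) (lazy α y (ν y)) cost∞
        k≈       : k ≈ (1# - cost∞) * (1# - α) ⁻¹

    -- The normalised product of the two measures is a plan, which makes the Wasserstein distance
    -- finite.
    scaledCurvature : ∀ {α} → 0# ≤ α → α ≤ 1# → ∃ (ScaledCurvature α)
    scaledCurvature {α} 0≤α α≤1 =
      let w , W-value , inf = W₁-value D-finite (μ≈lazy α x) (μ≈lazy α y)
            (lazy-∉ α covers-x x∈L) (lazy-∉ α covers-y y∈L) n≤1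
            (couple (0≤lazy 0≤α α≤1 λ v _ → 0≤ν x v) 0≤n
              (≈-trans (S-lazy x∈L Sνx≈1) (≈-sym (S-lazy y∈L Sνy≈1))))
      in _ , record { cost∞ = w ; W-value = W-value ; infimum∞ = inf ; k≈ = ≈-refl }
      where
      0≤n : NonNegative (lazy α y (ν y))
      0≤n = 0≤lazy 0≤α α≤1 λ v _ → 0≤ν y v

      n≤1 : ∀ v → lazy α y (ν y) v ≤ 1#
      n≤1 v with lem {v ∈ L}
      ... | yes v∈L = ≤-respʳ-≈ (S-lazy y∈L Sνy≈1) (term≤S 0≤n v∈L)
      ... | no  v∉L = ≤-respˡ-≈ (≈-sym (lazy-∉ α covers-y y∈L v v∉L)) 0≤1

    scaledCurvature-unique : ∀ {α k l} → ScaledCurvature α k → ScaledCurvature α l → k ≈ l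
    scaledCurvature-unique K K′ = ≈-trans (ScaledCurvature.k≈ K) (≈-trans
      (*-congʳ (+-congˡ (-‿cong (value-unique (ScaledCurvature.W-value K) (ScaledCurvature.W-value K′)))))
      (≈-sym (ScaledCurvature.k≈ K′)))

    ollivierRicci : ∀ {α k} → ScaledCurvature α k → ∃ λ c → IsOllivierRicci α x y c × k ≈ c * (1# - α) ⁻¹
    ollivierRicci {α} {k} K with ScaledCurvature.W-value K
    ... | m , W≈m , m≈w = 1# - w ,
      (1 , m , distance-∼ x∼y , (λ ()) , W≈m , +-congˡ (-‿cong (≈-trans (≈-sym m≈w)
        (≈-trans (≈-sym (*-identityʳ _)) (*-congˡ (≈-sym [1]⁻¹≈1)))))) , ScaledCurvature.k≈ K
      where
      w = ScaledCurvature.cost∞ K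
      [1]⁻¹≈1 : fromℕ 1 ⁻¹ ≈ 1#
      [1]⁻¹≈1 = ≈-trans (≈-sym (*-identityˡ _)) (≈-trans (*-congʳ (≈-sym (+-identityʳ 1#)))
        (*-inverseʳ (fromℕ 1) (0<x⇒x≉0 (0<fromℕ[1+n] 0))))

    0<r-1 : ∀ {r} → Uniform r → 0# < fromℕ r - 1#
    0<r-1 uniform = let _ , e , _ = x∼y in 0<fromℕ-1 (≡.subst (2 ℕ.≤_) (uniform e) (proj₁ simple e))

    0<d[r-1]+1 : ∀ {r} → Uniform r → ∀ d → 0# < fromℕ d * (fromℕ r - 1#) + 1#
    0<d[r-1]+1 uniform d = 0<x+1 (*-nonNegative (0≤fromℕ d) (proj₁ (0<r-1 uniform)))

    module _ {α β : Carrier} (0≤α : 0# ≤ α) (α≤β : α ≤ β) (β<1 : β < 1#) where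

      private
        0<1-β : 0# < 1# - β
        0<1-β = a<b⇒0<b-a β<1

        1-β≤1-α : 1# - β ≤ 1# - α
        1-β≤1-α = ≤-slack (β - α) (a≤b⇒0≤b-a α≤β)
          (solve 2 (λ α β → :1 :- α := (:1 :- β) :+ (β :- α)) ≈-refl α β)

        0<1-α : 0# < 1# - α
        0<1-α = ≤-trans (proj₁ 0<1-β) 1-β≤1-α , λ 0≈1-α →
          0<x⇒x≉0 0<1-β (squeeze (proj₁ 0<1-β) 1-β≤1-α (≈-sym 0≈1-α))

        i = (1# - α) ⁻¹
        θ = (1# - β) * i

        θ[1-α]≈1-β : θ * (1# - α) ≈ 1# - β
        θ[1-α]≈1-β = ≈-trans (solve 3 (λ b i a → b :* i :* a := b :* (a :* i)) ≈-refl (1# - β) i (1# - α))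
          (≈-trans (*-congˡ (*-inverseʳ _ (0<x⇒x≉0 0<1-α))) (*-identityʳ _))

        0<θ : 0# < θ
        0<θ = *-nonNegative (proj₁ 0<1-β) (0≤x⁻¹ 0<1-α) , λ 0≈θ →
          proj₂ 0<1-β (≈-trans (≈-sym (zeroˡ _)) (≈-trans (*-congʳ 0≈θ) θ[1-α]≈1-β))

        θ≤1 : θ ≤ 1#
        θ≤1 = ≤-respʳ-≈ (*-inverseʳ _ (0<x⇒x≉0 0<1-α)) (*-monoʳ-≤ i (0≤x⁻¹ 0<1-α) 1-β≤1-α)

      scaledCurvature-constant : Reroutable D (lazy β x (ν x)) (lazy β y (ν y)) x y (1# - θ) →
        ∀ {k} → ScaledCurvature α k → ScaledCurvature β k
      scaledCurvature-constant reroutable {k} K =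
        record { cost∞ = cost∞ ; W-value = W-value ; infimum∞ = infimum∞ ; k≈ = begin-equality
          k                                    ≈⟨ K.k≈ ⟩
          (1# - K.cost∞) * i                   ≈⟨ *-identityˡ _ ⟨
          1# * ((1# - K.cost∞) * i)            ≈⟨ *-congʳ (*-inverseʳ _ (0<x⇒x≉0 0<1-β)) ⟨
          ((1# - β) * (1# - β) ⁻¹) * ((1# - K.cost∞) * i)
            ≈⟨ solve 4 (λ b j c i → (b :* j) :* (c :* i) := (b :* i :* c) :* j)
                 ≈-refl (1# - β) ((1# - β) ⁻¹) (1# - K.cost∞) i ⟩
          (θ * (1# - K.cost∞)) * (1# - β) ⁻¹   ≈⟨ *-congʳ (infimum-affine 0<θ θ≤1 θ[1-α]≈1-β x∈L y∈L
                                                   Dxy≈1 reroutable K.infimum∞ infimum∞) ⟨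
          (1# - cost∞) * (1# - β) ⁻¹           ∎ }
        where
        open ≤-Reasoning
        module K = ScaledCurvature K
        open ScaledCurvature (proj₂ (scaledCurvature (≤-trans 0≤α α≤β) (proj₁ β<1)))

      constant-half : 1# ≤ α + α → ∀ {k} → ScaledCurvature α k → ScaledCurvature β k
      constant-half 1≤2α = scaledCurvature-constant
        (reroutable-half 0<θ θ≤1 θ[1-α]≈1-β x∈L y∈L x≢y (λ v _ → 0≤ν x v) (λ v _ → 0≤ν y v)
          (ν-self x) (ν-self y) 0≤α (proj₁ β<1) Sνy≈1 1≤2α)

      module _ {r : ℕ} (uniform : Uniform r) (linear : Linear) where

        private
          R = (fromℕ r - 1#) ⁻¹

        -- At a common neighbour the two walks have mass 1 / (d (r - 1)) with their respective
        -- degrees, so `v`, of larger degree, puts no more there than `u` does. Every vertex not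
        -- adjacent to `u` is far, and one not adjacent to `v` receives nothing from `v`.
        reroutable-degree : ∀ {u v} → u ∈ L → v ∈ L → u ∼ v → degree u ℕ.≤ degree v →
          1# ≤ α * (fromℕ (degree v) * (fromℕ r - 1#) + 1#) →
          Reroutable D (lazy β u (ν u)) (lazy β v (ν v)) u v (1# - θ)
        reroutable-degree {u} {v} u∈L v∈L u∼v du≤dv 1≤α[N+1] =
          reroutable-heavy 0<θ θ≤1 θ[1-α]≈1-β u∈L v∈L (proj₁ u∼v) (λ w _ → 0≤ν u w) (λ w _ → 0≤ν v w)
            (ν-self u) (ν-self v) 0≤α (proj₁ β<1)
            D-self (λ a≢b → ≤-respˡ-≈ (+-identityʳ 1#) (fromℕ-mono-≤ (1≤dist a≢b)))
            (D-∼ u∼v) far⊎heavy zero⊎near lazy-enough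
          where
          open ≤-Reasoning
          D-self : ∀ w → D w w ≈ 0#
          D-self w rewrite dist-self w = ≈-refl

          D-∼ : u ∼ v → D u v ≈ 1#
          D-∼ u∼v rewrite dist-∼ u∼v = +-identityʳ 1#

          dv = fromℕ (degree v)
          du = fromℕ (degree u)

          dv⁻¹≤du⁻¹ : dv ⁻¹ ≤ du ⁻¹
          dv⁻¹≤du⁻¹ = ⁻¹-antimono (0<degree u∼v) (0<degree (∼-sym u∼v)) (fromℕ-mono-≤ du≤dv)

          far⊎heavy : ∀ z → z ≢ u → z ≢ v → 1# + 1# ≤ D u z ⊎ ν v z ≤ ν u z
          far⊎heavy z z≢u z≢v with lem {z ∼ u} | lem {z ∼ v}
          ... | no z≁u  | _       = inj₁ (≤-respˡ-≈ (+-congˡ (+-identityʳ 1#))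
            (fromℕ-mono-≤ (2≤dist (λ u≡z → z≢u (≡.sym u≡z)) λ u∼z → z≁u (∼-sym u∼z))))
          ... | yes _   | no z≁v  = inj₂ (≤-respˡ-≈ (≈-sym (ν-≁ z≁v)) (0≤ν u z))
          ... | yes z∼u | yes z∼v = inj₂ (≤-respˡ-≈ (≈-sym (ν-linear uniform linear z∼v))
            (≤-respʳ-≈ (≈-sym (ν-linear uniform linear z∼u)) (*-monoʳ-≤ R (0≤x⁻¹ (0<r-1 uniform)) dv⁻¹≤du⁻¹)))

          zero⊎near : ∀ w → w ≢ v → ν v w ≈ 0# ⊎ (∀ z → D z w ≤ D z v + 1#)
          zero⊎near w w≢v with lem {w ∼ v}
          ... | no  w≁v = inj₁ (ν-≁ w≁v)
          ... | yes w∼v = inj₂ λ z → ≤-respʳ-≈ (+-comm 1# _) (fromℕ-mono-≤ (dist-step (∼-sym w∼v) z))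

          N = dv * (fromℕ r - 1#)

          N*νu≈1 : N * ν v u ≈ 1#
          N*νu≈1 = begin-equality
            dv * (fromℕ r - 1#) * ν v u                ≈⟨ *-congˡ (ν-linear uniform linear u∼v) ⟩
            dv * (fromℕ r - 1#) * (dv ⁻¹ * R)
              ≈⟨ solve 4 (λ a b c d → a :* b :* (c :* d) := (a :* c) :* (b :* d))
                                                            ≈-refl dv (fromℕ r - 1#) (dv ⁻¹) R ⟩
            (dv * dv ⁻¹) * ((fromℕ r - 1#) * R)
              ≈⟨ *-cong (*-inverseʳ _ (0<x⇒x≉0 (0<degree (∼-sym u∼v))))
                                                                 (*-inverseʳ _ (0<x⇒x≉0 (0<r-1 uniform))) ⟩
            1# * 1#                                    ≈⟨ *-identityˡ 1# ⟩
            1#                                         ∎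

          0<N : 0# < N
          0<N = *-nonNegative (0≤fromℕ (degree v)) (proj₁ (0<r-1 uniform)) , λ 0≈N →
            0≉1 (≈-trans (≈-sym (zeroˡ (ν v u))) (≈-trans (*-congʳ 0≈N) N*νu≈1))

          -- Multiplying by `N`, the reciprocal of `ν v u`, turns the condition into (1 - α)(N + 1)
          -- ≤ N, that is α (N + 1) ≥ 1.
          lazy-enough : (1# - α) * (1# + ν v u) ≤ 1#
          lazy-enough = *-cancelˡ-≤ N 0<N (begin
            N * ((1# - α) * (1# + ν v u))
              ≈⟨ solve 3 (λ N α n → N :* ((:1 :- α) :* (:1 :+ n)) := (:1 :- α) :* (N :+ N :* n))
                                                    ≈-refl N α (ν v u) ⟩
            (1# - α) * (N + N * ν v u)         ≈⟨ *-congˡ (+-congˡ N*νu≈1) ⟩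
            (1# - α) * (N + 1#)                ≤⟨ ≤-slack (α * (N + 1#) - 1#) (a≤b⇒0≤b-a 1≤α[N+1])
                                                    (solve 2 (λ N α → N :* :1 := (:1 :- α) :* (N :+ :1) :+ (α :* (N :+ :1) :- :1)) ≈-refl N α) ⟩
            N * 1#                             ∎)

        1≤α[N+1] : ∀ d → (fromℕ d * (fromℕ r - 1#) + 1#) ⁻¹ ≤ α → 1# ≤ α * (fromℕ d * (fromℕ r - 1#) + 1#)
        1≤α[N+1] d M⁻¹≤α =
            ≤-respˡ-≈ (≈-trans (*-comm _ _) (*-inverseʳ M (0<x⇒x≉0 0<M))) (*-monoʳ-≤ M (proj₁ 0<M) M⁻¹≤α)
          where
          M   = fromℕ d * (fromℕ r - 1#) + 1#
          0<M = 0<d[r-1]+1 uniform d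

        -- The maximum of the degrees is the degree of the target end, once the end of smaller
        -- degree is taken as the source of the exchange.
        constant-linear : (fromℕ (degree x ℕ.⊔ degree y) * (fromℕ r - 1#) + 1#) ⁻¹ ≤ α →
          ∀ {k} → ScaledCurvature α k → ScaledCurvature β k
        constant-linear bound = scaledCurvature-constant (by-cases (ℕₚ.≤-total (degree x) (degree y)))
          where
          bound-at : ∀ {d} → degree x ℕ.⊔ degree y ≡ d → (fromℕ d * (fromℕ r - 1#) + 1#) ⁻¹ ≤ α
          bound-at eq = ≡.subst (λ d → (fromℕ d * (fromℕ r - 1#) + 1#) ⁻¹ ≤ α) eq bound

          by-cases : degree x ℕ.≤ degree y ⊎ degree y ℕ.≤ degree x →
                     Reroutable D (lazy β x (ν x)) (lazy β y (ν y)) x y (1# - θ)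
          by-cases (inj₁ dx≤dy) = reroutable-degree x∈L y∈L x∼y dx≤dy
            (1≤α[N+1] (degree y) (bound-at (ℕₚ.m≤n⇒m⊔n≡n dx≤dy)))
          by-cases (inj₂ dy≤dx) = Reroutable-swap (λ u v → ≈-reflexive (≡.cong fromℕ (dist-sym u v)))
            (reroutable-degree y∈L x∈L (∼-sym x∼y) dy≤dx
              (1≤α[N+1] (degree x) (bound-at (ℕₚ.m≥n⇒m⊔n≡m dy≤dx))))

    module _ {κ : Carrier} (at-½ : ScaledCurvature ½ κ) where

      from-½ : ∀ α → ½ ≤ α → α < 1# → ∃ λ c → IsOllivierRicci α x y c × κ ≈ c * (1# - α) ⁻¹
      from-½ α ½≤α α<1 =
        ollivierRicci (constant-half (proj₁ 0<½) ½≤α α<1 (≤-reflexive (≈-sym ½+½≈1)) at-½)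

      -- For α ≤ 1/2, constancy is applied from α up to 1/2, and uniqueness of the value at 1/2
      -- identifies it with `κ`. Above 1/2 the general claim applies.
      from-linear : ∀ r → Uniform r → Linear →
        ∀ α → (fromℕ (degree x ℕ.⊔ degree y) * (fromℕ r - 1#) + 1#) ⁻¹ ≤ α → α < 1# →
        ∃ λ c → IsOllivierRicci α x y c × κ ≈ c * (1# - α) ⁻¹
      from-linear r uniform linear α bound α<1 = by-cases (total ½ α)
        where
        0≤α : 0# ≤ α
        0≤α = ≤-trans (0≤x⁻¹ (0<d[r-1]+1 uniform (degree x ℕ.⊔ degree y))) bound

        by-cases : ½ ≤ α ⊎ α ≤ ½ → ∃ λ c → IsOllivierRicci α x y c × κ ≈ c * (1# - α) ⁻¹
        by-cases (inj₁ ½≤α) = from-½ α ½≤α α<1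
        by-cases (inj₂ α≤½) =
          let k , K            = scaledCurvature 0≤α (proj₁ α<1)
              c , ricci , k≈   = ollivierRicci K
              κ≈k              =
                  scaledCurvature-unique at-½ (constant-linear 0≤α α≤½ ½<1 uniform linear bound K)
          in c , ricci , ≈-trans κ≈k k≈

      linLuYau : IsLinLuYau x y κ
      -- The radius 1/2 serves every `ε`: for α between 1/2 and 1 the quotient equals `κ`, so the
      -- gap is zero.
      linLuYau ε 0<ε = ½ , 0<½ , λ α _ 1-½<α α<1 →
        let c , ricci , κ≈ = from-½ α (≤-respˡ-≈ 1-½≈½ (proj₁ 1-½<α)) α<1
            0≈gap          = ≈-sym (≈-trans (+-congˡ (-‿cong κ≈)) (-‿inverseʳ _))
        in c , ricci , <-respʳ-≈ 0≈gap (0<x⇒-x<0 0<ε) , <-respˡ-≈ 0≈gap 0<ε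

corollary1p5 :
  (lem : ExcludedMiddle 0ℓ) (ℛ : CompleteOrderedField)
  (ℋ : Hypergraph) (locallyFinite : Hypergraph.LocallyFinite ℋ) →
  let open CompleteOrderedField ℛ
      open Hypergraph ℋ
      open Curvature lem ℛ ℋ locallyFinite
  in
  Simple → ∀ x y → x ∼ y →
  ∃ λ κ → IsLinLuYau x y κ ×
    (∀ α → ½ ≤ α → α < 1# →
       ∃ λ c → IsOllivierRicci α x y c × κ ≈ c * (1# - α) ⁻¹) ×
    (∀ r → Uniform r → Linear →
       ∀ α → (fromℕ (degree x ℕ.⊔ degree y) * (fromℕ r - 1#) + 1#) ⁻¹ ≤ α → α < 1# →
         ∃ λ c → IsOllivierRicci α x y c × κ ≈ c * (1# - α) ⁻¹)
corollary1p5 lem ℛ ℋ locallyFinite simple x y x∼y =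
  let κ , at-½ = scaledCurvature x∼y (proj₁ 0<½) (proj₁ ½<1)
  in κ , linLuYau x∼y at-½ , from-½ x∼y at-½ , from-linear x∼y at-½
  where
  open OrderedField ℛ using (0<½; ½<1)
  open AdjacentVertices lem ℛ ℋ locallyFinite simple
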